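{- For every integer $n \ge 5$, $$\operatorname{ex}_2(n,K_3) = \left\lfloor \frac{(n-1)^2}{4} \right\rfloor + 1 .$$ Moreover, the extremal graphs, i.e. the $n$-vertex graphs $G$ such that $G_2$ is triangle-free and $|E(G_2)|=\operatorname{ex}_2(n,K_3)$, are (up to isomorphism) exactly the complements of the graphs obtained by the following construction: take the Turán graph $T(n-1,2)$ with bipartition $(A,B)$ (either of the two colour classes may play the role of $A$), fix a vertex $a_1 \in A$ and a non-trivial partition $B = B' \cup B''$ (that is, $B'$ and $B''$ are disjoint and both non-empty), remove all edges between $a_1$ and $B'$, and add a new vertex $a_2$ whose neighbourhood is exactly $\{a_1\} \cup B'$.
   Context: All graphs are finite, simple and undirected, and need not be connected. For a graph $G$ and an integer $k\ge 1$, the $k$-distance graph $G_k$ is the graph on vertex set $V(G)$ in which two vertices are adjacent if and only if their distance in $G$ is exactly $k$ (vertices in different components of $G$ are not adjacent in $G_k$). For a fixed graph $H$, define $$\operatorname{ex}_k(n,H):=\max\{|E(G_k)| : |V(G)|=n \text{ and } G_k \text{ is } H\text{ -free}\},$$ where $H$-free means containing no subgraph isomorphic to $H$. The Turán graph $T(m,2)$ is the complete bipartite graph on $m$ vertices whose two colour classes have sizes $\lfloor m/2\rfloor$ and $\lceil m/2\rceil$. -}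

module Defs where

open import Data.Empty using (⊥)
open import Data.Fin using (Fin; zero; suc; _<_; _<?_; _≟_)
open import Data.Fin.Properties using (any?)
open import Data.Fin.Subset
  using (Subset; _∈_; _∪_; _∩_; ∁; ⁅_⁆; Empty; Nonempty; ∣_∣)
open import Data.Fin.Subset.Properties using (_∈?_)
open import Data.List using (List; allFin; cartesianProduct; filter; length)
open import Data.Nat using (ℕ; zero; suc; NonZero; >-nonZero⁻¹; ⌊_/2⌋; ⌈_/2⌉)
import Data.Nat as ℕ
open import Data.Nat.Properties using (allUpTo?)
open import Data.Product using (Σ-syntax; _×_; _,_)
open import Data.Sum using (_⊎_; inj₁; inj₂; swap)
open import Function using (_∘_)
open import Function.Bundles using (_↔_; _⇔_; _↣_; Inverse; Injection)
open import Level using (Level; 0ℓ)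
open import Relation.Binary using (Rel; Symmetric; Decidable)
open import Relation.Binary.PropositionalEquality using (_≡_; _≢_; refl; sym)
open import Relation.Nullary using (¬_; no)
open import Relation.Nullary.Decidable using (map′; ¬?; _×-dec_; _⊎-dec_)

private
  variable
    ℓ : Level
    k m n : ℕ

record Graph (n : ℕ) : Set₁ where
  field
    Adj        : Rel (Fin n) 0ℓ
    adj?       : Decidable Adj
    adj-sym    : Symmetric Adj
    adj-irrefl : ∀ {u} → ¬ Adj u u

open Graph public

-- Each undirected edge is listed once, by its ordered pair of endpoints u < v.
edges : Graph n → List (Fin n × Fin n)
edges {n} G =
  filter (λ (u , v) → (u <? v) ×-dec adj? G u v)
         (cartesianProduct (allFin n) (allFin n))

∣E_∣ : Graph n → ℕ
∣E G ∣ = length (edges G)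

infix 4 _≅_

_≅_ : Graph m → Graph n → Set
_≅_ {m} {n} G H =
  Σ[ φ ∈ Fin m ↔ Fin n ]
    (∀ u v → Adj G u v ⇔ Adj H (Inverse.to φ u) (Inverse.to φ v))

-- The subgraph need not be induced, so adjacency is only preserved.
Contains : Graph m → Graph n → Set
Contains {m} {n} H G =
  Σ[ f ∈ Fin m ↣ Fin n ]
    (∀ {u v} → Adj H u v → Adj G (Injection.to f u) (Injection.to f v))

Free : Graph m → Graph n → Set
Free H G = ¬ Contains H G

complete : ∀ n → Graph n
complete n = record
  { Adj        = _≢_
  ; adj?       = λ u v → ¬? (u ≟ v)
  ; adj-sym    = λ u≢v → u≢v ∘ sym
  ; adj-irrefl = λ u≢u → u≢u refl
  }

complement : Graph n → Graph n
complement G = record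
  { Adj        = λ u v → u ≢ v × ¬ Adj G u v
  ; adj?       = λ u v → ¬? (u ≟ v) ×-dec ¬? (adj? G u v)
  ; adj-sym    = λ (u≢v , ¬uv) → u≢v ∘ sym , ¬uv ∘ adj-sym G
  ; adj-irrefl = λ (u≢u , _) → u≢u refl
  }

data Walk (G : Graph n) : ℕ → Rel (Fin n) 0ℓ where
  []  : ∀ {u} → Walk G 0 u u
  _∷_ : ∀ {k u v w} → Adj G u v → Walk G k v w → Walk G (suc k) u w

-- "The distance from u to v is k".  A shortest walk is a shortest path, and
-- vertices in different components are at no distance.
Distance : Graph n → ℕ → Rel (Fin n) 0ℓ
Distance G k u v = Walk G k u v × (∀ {j} → j ℕ.< k → ¬ Walk G j u v)

module _ (G : Graph n) where

  walk? : ∀ k → Decidable (Walk G k)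
  walk? zero    u v = map′ (λ { refl → [] }) (λ { [] → refl }) (u ≟ v)
  walk? (suc k) u w =
    map′ (λ (_ , a , p) → a ∷ p) (λ { (a ∷ p) → _ , a , p })
         (any? λ v → adj? G u v ×-dec walk? k v w)

  snoc : ∀ {u v w} → Walk G k u v → Adj G v w → Walk G (suc k) u w
  snoc []      b = b ∷ []
  snoc (a ∷ p) b = a ∷ snoc p b

  reverse : Symmetric (Walk G k)
  reverse []      = []
  reverse (a ∷ p) = snoc (reverse p) (adj-sym G a)

  distance? : ∀ k → Decidable (Distance G k)
  distance? k u v = walk? k u v ×-dec allUpTo? (λ j → ¬? (walk? j u v)) k

distanceGraph : ∀ k → .{{NonZero k}} → Graph n → Graph n
distanceGraph k G = record
  { Adj        = Distance G k
  ; adj?       = distance? G k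
  ; adj-sym    = λ (p , shortest) →
                   reverse G p , λ j<k → shortest j<k ∘ reverse G
  ; adj-irrefl = λ (_ , shortest) → shortest (>-nonZero⁻¹ k) []
  }

IsMaximum : (ℕ → Set ℓ) → ℕ → Set ℓ
IsMaximum P e = P e × (∀ {d} → P d → d ℕ.≤ e)

-- "ex_k(n,H) = e".  A maximum is unique, so this relation determines e.
IsEx : ∀ k → .{{NonZero k}} → ℕ → Graph m → ℕ → Set₁
IsEx k n H =
  IsMaximum λ e →
    Σ[ G ∈ Graph n ] (Free H (distanceGraph k G) × ∣E distanceGraph k G ∣ ≡ e)

IsExtremal : ∀ k → .{{NonZero k}} → Graph m → Graph n → Set₁
IsExtremal {n = n} k H G =
  Free H (distanceGraph k G) × IsEx k n H ∣E distanceGraph k G ∣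

completeBipartite : Subset n → Graph n
completeBipartite A = record
  { Adj        = λ u v → Across u v ⊎ Across v u
  ; adj?       = λ u v → across? u v ⊎-dec across? v u
  ; adj-sym    = swap
  ; adj-irrefl = λ { (inj₁ (u∈A , u∉A)) → u∉A u∈A
                   ; (inj₂ (u∈A , u∉A)) → u∉A u∈A }
  }
  where
  Across : Rel (Fin _) 0ℓ
  Across u v = u ∈ A × ¬ v ∈ A
  across? : Decidable Across
  across? u v = (u ∈? A) ×-dec ¬? (v ∈? A)

-- completeBipartite A is a copy of T(n,2); A may be the smaller or the larger
-- of its two colour classes.
IsTuránClass : Subset n → Set
IsTuránClass {n} A =
    (∣ A ∣ ≡ ⌊ n /2⌋ × ∣ ∁ A ∣ ≡ ⌈ n /2⌉)
  ⊎ (∣ A ∣ ≡ ⌈ n /2⌉ × ∣ ∁ A ∣ ≡ ⌊ n /2⌋)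

removeEdgesBetween : Fin n → Subset n → Graph n → Graph n
removeEdgesBetween a S G = record
  { Adj        = λ u v → Adj G u v × ¬ Removed u v × ¬ Removed v u
  ; adj?       = λ u v → adj? G u v ×-dec ¬? (removed? u v) ×-dec ¬? (removed? v u)
  ; adj-sym    = λ (uv , p , q) → adj-sym G uv , q , p
  ; adj-irrefl = λ (uu , _) → adj-irrefl G uu
  }
  where
  Removed : Rel (Fin _) 0ℓ
  Removed u v = u ≡ a × v ∈ S
  removed? : Decidable Removed
  removed? u v = (u ≟ a) ×-dec (v ∈? S)

-- The new vertex is zero, with neighbourhood N; each old vertex v becomes suc v.
addVertex : Subset n → Graph n → Graph (suc n)
addVertex {n} N G = record
  { Adj        = Adj⁺
  ; adj?       = adj⁺?
  ; adj-sym    = λ {u} {v} → adj⁺-sym u v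
  ; adj-irrefl = λ {u} → adj⁺-irrefl u
  }
  where
  Adj⁺ : Rel (Fin (suc n)) 0ℓ
  Adj⁺ zero    zero    = ⊥
  Adj⁺ zero    (suc v) = v ∈ N
  Adj⁺ (suc u) zero    = u ∈ N
  Adj⁺ (suc u) (suc v) = Adj G u v

  adj⁺? : Decidable Adj⁺
  adj⁺? zero    zero    = no λ ()
  adj⁺? zero    (suc v) = v ∈? N
  adj⁺? (suc u) zero    = u ∈? N
  adj⁺? (suc u) (suc v) = adj? G u v

  adj⁺-sym : ∀ u v → Adj⁺ u v → Adj⁺ v u
  adj⁺-sym zero    (suc v) p = p
  adj⁺-sym (suc u) zero    p = p
  adj⁺-sym (suc u) (suc v) p = adj-sym G p

  adj⁺-irrefl : ∀ u → ¬ Adj⁺ u u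
  adj⁺-irrefl (suc u) = adj-irrefl G

record Construction (m : ℕ) : Set where
  field
    A           : Subset m
    turán       : IsTuránClass A
    a₁          : Fin m
    a₁∈A        : a₁ ∈ A
    B′ B″       : Subset m
    cover       : B′ ∪ B″ ≡ ∁ A
    disjoint    : Empty (B′ ∩ B″)
    B′-nonempty : Nonempty B′
    B″-nonempty : Nonempty B″

  graph : Graph (suc m)
  graph = addVertex (⁅ a₁ ⁆ ∪ B′) (removeEdgesBetween a₁ B′ (completeBipartite A))

{-# OPTIONS --safe #-}
module Submission where

-- Let H = G₂ have n = m + 1 vertices. If H is bipartite with sides X and Y, no x ∈ X and y ∈ Y can be
-- complete to the opposite sides: x and y would be H-adjacent, and their common G-neighbour would
-- be H-adjacent to one of them. So one side has a non-neighbour for each of its vertices, and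
-- |E(H)| ≤ (|X| − 1)|Y| or |X|(|Y| − 1).
--
-- Otherwise let v have maximum degree Δ in H, N = N(v) and S = V ∖ N. As N is independent,
-- |E(H)| = Σ_{u ∈ S} d(u) − e(S), and S contains an edge xy. Now d(x) + d(y) ≤ Δ + d_S(x) + d_S(y),
-- since no vertex of N sees both ends, and d_S(x) + d_S(y) ≤ e(S) + 1; hence
-- |E(H)| ≤ Δ(n − 1 − Δ) + 1. Equality makes every step tight, and H is then a blow-up of the 5-cycle
-- with two adjacent singleton classes, either because S spans the single edge xy or because it
-- spans a star. Finally, midpoints of the edges of such an H force G to be its full complement.

open import Defs
open import Data.Bool using (if_then_else_; true; false)
open import Data.Empty using (⊥; ⊥-elim)
open import Data.Fin using (Fin; zero; suc; _≟_; _<?_)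
open import Data.Fin.Patterns
open import Data.Fin.Permutation using (_⟨$⟩ʳ_; _⟨$⟩ˡ_; inverseˡ; inverseʳ)
import Data.Fin.Permutation as Perm
open import Data.Fin.Properties using (any?; all?)
import Data.Fin.Properties as Fin
open import Data.Fin.Subset using (Subset; _∈_; _∉_; _∪_; ∁; ⁅_⁆; ∣_∣; inside; outside)
open import Data.Fin.Subset.Properties
  using (_∈?_; x∈p∪q⁺; x∈p∪q⁻; x∈p∩q⁺; x∈p∩q⁻; x∈⁅x⁆; x∈⁅y⁆⇒x≡y; x∈∁p⇒x∉p; x∉p⇒x∈∁p; ⊆-antisym)
import Data.List as List
open import Data.List using (cartesianProduct; filter; length)
open import Data.List.Properties using (filter-++; length-++; map-tabulate)
open import Data.Nat as Nat hiding (_≟_; _<?_; _≤?_)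
open import Data.Nat.Divisibility using (n∣m*n)
open import Data.Nat.DivMod
open import Data.Nat.Properties hiding (_≟_; _<?_)
open import Data.Nat.Tactic.RingSolver using (solve-∀)
open import Algebra.Properties.Semiring.Sum +-*-semiring
  using (sum; sum-cong-≗; ∑-distrib-+; ∑-comm; *-distribˡ-sum; *-distribʳ-sum; sum-permute; sum-replicate-zero)
open import Data.Product using (_×_; _,_; proj₁; proj₂; ∃; Σ-syntax)
open import Data.Sum using (_⊎_; inj₁; inj₂; [_,_]′; swap)
open import Data.Vec using ([]; _∷_; tabulate)
open import Data.Vec.Properties using (lookup∘tabulate; lookup⇒[]=; []=⇒lookup)
open import Function using (_∘_; id; case_of_)
open import Function.Bundles using (_⇔_; mk⇔; mk↣; Equivalence; _↔_)
open import Level using (Level; 0ℓ)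
open import Relation.Binary using (Decidable; tri<; tri≈; tri>)
open import Relation.Binary.PropositionalEquality
open import Relation.Nullary
open import Relation.Nullary.Decidable
  using (¬?; _×-dec_; _⊎-dec_; _→-dec_; decidable-stable; dec-true; dec-false; False; toWitness; toWitnessFalse)
open import Relation.Unary using (Pred) renaming (Decidable to Decidable₁)
open Equivalence using (to; from)

-- A balanced complete bipartite graph is triangle-free with about n²/4 edges, so triangle-freeness
-- alone cannot give the bound. The edge bound uses that H is a distance graph only through the
-- bipartite case; the rest of the counting treats an arbitrary triangle-free graph and takes that
-- case as a hypothesis. The number m arises because v lies in S: with |S| = s + 1 the sizes satisfy
-- s + Δ = m, so sΔ is at most the floor of m²/4. The final + 1 is the edge xy, which both d_S(x)
-- and d_S(y) count. In the equality case every edge of S meets xy. Any edge of S may take the place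
-- of xy, so the edges of S meet pairwise, and without triangles they form a star, perhaps a single
-- edge. The two cases place N on opposite sides of the construction: N is B for a single edge and A
-- for a larger star. The counting inequalities are proved term by term before summing, so that
-- equality of the sums can be read back at each vertex or pair. The hypothesis on n makes all five
-- classes of the blow-up nonempty, as the midpoint arguments require.

private
  variable
    ℓ : Level
    m n : ℕ
    P Q : Set ℓ

-- Sums and edge counts

-- With the larger part written as `a + k`, the square is four times the product plus `k * k`. The
-- floor therefore exceeds the product by exactly `k * k / 4`, which vanishes only for `k ≤ 1`; the
-- bound and its equality case both rest on this.
[2a+k]²/4 : ∀ a k → (a + (a + k)) ^ 2 / 4 ≡ a * (a + k) + k * k / 4
[2a+k]²/4 a k = begin
  (a + (a + k)) ^ 2 / 4                ≡⟨ /-congˡ {o = 4} (expand a k) ⟩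
  (a * (a + k) * 4 + k * k) / 4        ≡⟨ +-distrib-/-∣ˡ (k * k) (n∣m*n (a * (a + k))) ⟩
  a * (a + k) * 4 / 4 + k * k / 4      ≡⟨ cong (_+ k * k / 4) (m*n/n≡m (a * (a + k)) 4) ⟩
  a * (a + k) + k * k / 4              ∎
  where
  open ≡-Reasoning
  expand : ∀ a k → (a + (a + k)) * ((a + (a + k)) * 1) ≡ a * (a + k) * 4 + k * k
  expand = solve-∀

a*b≤[a+b]²/4 : ∀ a b → a * b ≤ (a + b) ^ 2 / 4
a*b≤[a+b]²/4 a b with ≤-total a b
... | inj₁ a≤b with k , refl ← m≤n⇒∃[o]m+o≡n a≤b =
  ≤-trans (m≤m+n _ _) (≤-reflexive (sym ([2a+k]²/4 a k)))
... | inj₂ b≤a with k , refl ← m≤n⇒∃[o]m+o≡n b≤a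
  rewrite *-comm (b + k) b | +-comm (b + k) b =
  ≤-trans (m≤m+n _ _) (≤-reflexive (sym ([2a+k]²/4 b k)))

private
  tight⇒halves : ∀ a k → a * (a + k) ≡ (a + (a + k)) ^ 2 / 4 →
                 a ≡ ⌊ a + (a + k) /2⌋ × a + k ≡ ⌈ a + (a + k) /2⌉
  tight⇒halves a k eq with k | +-cancelˡ-≡ (a * (a + k)) _ _ (trans (+-identityʳ _) (trans eq ([2a+k]²/4 a k)))
  ... | 0 | _ rewrite +-identityʳ a = n≡⌊n+n/2⌋ a , n≡⌈n+n/2⌉ a
  ... | 1 | _ rewrite +-comm a 1 | +-suc a a = n≡⌈n+n/2⌉ a , cong suc (n≡⌊n+n/2⌋ a)
  ... | suc (suc k) | q =
    contradiction (sym q)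
      (m<n⇒n≢0 (m≥n⇒m/n>0 {suc (suc k) * suc (suc k)} {4}
        (*-mono-≤ {2} {suc (suc k)} {2} (s≤s (s≤s z≤n)) (s≤s (s≤s z≤n)))))

a*b≡[a+b]²/4⇒halves : ∀ a b → a * b ≡ (a + b) ^ 2 / 4 →
  (a ≡ ⌊ a + b /2⌋ × b ≡ ⌈ a + b /2⌉) ⊎ (a ≡ ⌈ a + b /2⌉ × b ≡ ⌊ a + b /2⌋)
a*b≡[a+b]²/4⇒halves a b eq with ≤-total a b
... | inj₁ a≤b with k , refl ← m≤n⇒∃[o]m+o≡n a≤b = inj₁ (tight⇒halves a k eq)
... | inj₂ b≤a with k , refl ← m≤n⇒∃[o]m+o≡n b≤a
  rewrite *-comm (b + k) b | +-comm (b + k) b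
  with p , q ← tight⇒halves b k eq = inj₂ (q , p)

private
  gap : ∀ m → ∃ λ k → ⌈ m /2⌉ ≡ ⌊ m /2⌋ + k × k ≤ 1
  gap 0 = 0 , refl , z≤n
  gap 1 = 1 , refl , s≤s z≤n
  gap (suc (suc m)) with k , eq , k≤1 ← gap m = k , cong suc eq , k≤1

⌊m/2⌋*⌈m/2⌉≡m²/4 : ∀ m → ⌊ m /2⌋ * ⌈ m /2⌉ ≡ m ^ 2 / 4
⌊m/2⌋*⌈m/2⌉≡m²/4 m with k , eq , k≤1 ← gap m = begin
  ⌊ m /2⌋ * ⌈ m /2⌉                             ≡⟨ cong (⌊ m /2⌋ *_) eq ⟩
  ⌊ m /2⌋ * (⌊ m /2⌋ + k)                       ≡⟨ sym (+-identityʳ _) ⟩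
  ⌊ m /2⌋ * (⌊ m /2⌋ + k) + 0
    ≡⟨ cong (⌊ m /2⌋ * (⌊ m /2⌋ + k) +_) (sym (m<n⇒m/n≡0 (s≤s (≤-trans (*-mono-≤ k≤1 k≤1) (s≤s z≤n))))) ⟩
  ⌊ m /2⌋ * (⌊ m /2⌋ + k) + k * k / 4           ≡⟨ [2a+k]²/4 ⌊ m /2⌋ k ⟨
  (⌊ m /2⌋ + (⌊ m /2⌋ + k)) ^ 2 / 4             ≡⟨ cong (λ z → (⌊ m /2⌋ + z) ^ 2 / 4) eq ⟨
  (⌊ m /2⌋ + ⌈ m /2⌉) ^ 2 / 4                   ≡⟨ cong (λ z → z ^ 2 / 4) (⌊n/2⌋+⌈n/2⌉≡n m) ⟩
  m ^ 2 / 4                                     ∎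
  where
  open ≡-Reasoning

𝟙 : Dec P → ℕ
𝟙 p = if does p then 1 else 0

𝟙-yes : (p : Dec P) → P → 𝟙 p ≡ 1
𝟙-yes p x rewrite dec-true p x = refl

𝟙-no : (p : Dec P) → ¬ P → 𝟙 p ≡ 0
𝟙-no p ¬x rewrite dec-false p ¬x = refl

𝟙-cong : (p : Dec P) (q : Dec Q) → (P → Q) → (Q → P) → 𝟙 p ≡ 𝟙 q
𝟙-cong (yes x) q f g = sym (𝟙-yes q (f x))
𝟙-cong (no ¬x) q f g = sym (𝟙-no q (¬x ∘ g))

𝟙≡1⇒ : (p : Dec P) → 𝟙 p ≡ 1 → P
𝟙≡1⇒ (yes x) _ = x

sum-mono : ∀ {f g : Fin n → ℕ} → (∀ i → f i ≤ g i) → sum f ≤ sum g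
sum-mono {zero}  f≤g = z≤n
sum-mono {suc n} f≤g = +-mono-≤ (f≤g zero) (sum-mono (f≤g ∘ suc))

tight : ∀ {a b c d} → a ≤ b → c ≤ d → b + d ≤ a + c → a ≡ b × c ≡ d
tight {a} {b} {c} {d} a≤b c≤d b+d≤a+c =
  ≤-antisym a≤b (+-cancelʳ-≤ d b a (≤-trans b+d≤a+c (+-monoʳ-≤ a c≤d))) ,
  ≤-antisym c≤d (+-cancelˡ-≤ b d c (≤-trans b+d≤a+c (+-monoˡ-≤ c a≤b)))

-- The source of all structural information: equality in a summed estimate becomes equality at every
-- vertex.
sum-tight : ∀ {f g : Fin n → ℕ} → (∀ i → f i ≤ g i) → sum g ≡ sum f → ∀ i → f i ≡ g i
sum-tight {suc n} f≤g g≡f = λ where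
    zero    → proj₁ split
    (suc i) → sum-tight (f≤g ∘ suc) (sym (proj₂ split)) i
  where split = tight (f≤g zero) (sum-mono (f≤g ∘ suc)) (≤-reflexive g≡f)

sum-1 : ∀ n → sum {n} (λ _ → 1) ≡ n
sum-1 zero    = refl
sum-1 (suc n) = cong suc (sum-1 n)

sum-δ : ∀ (x : Fin n) (f : Fin n → ℕ) → sum (λ i → 𝟙 (i ≟ x) * f i) ≡ f x
sum-δ {suc n} zero f = begin
  f zero + 0 + sum {n} (λ _ → 0) ≡⟨ cong₂ _+_ (+-identityʳ (f zero)) (sum-replicate-zero n) ⟩
  f zero + 0                ≡⟨ +-identityʳ (f zero) ⟩
  f zero                    ∎
  where open ≡-Reasoning
sum-δ {suc n} (suc x) f = sum-δ x (f ∘ suc)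

sum-𝟙≟ : ∀ (x : Fin n) → sum (λ i → 𝟙 (i ≟ x)) ≡ 1
sum-𝟙≟ x = trans (sum-cong-≗ λ i → sym (*-identityʳ (𝟙 (i ≟ x)))) (sum-δ x λ _ → 1)

Σ₂ : (Fin n → Fin n → ℕ) → ℕ
Σ₂ f = sum λ i → sum (f i)

Σ₂-mono : ∀ {f g : Fin n → Fin n → ℕ} → (∀ i j → f i j ≤ g i j) → Σ₂ f ≤ Σ₂ g
Σ₂-mono f≤g = sum-mono λ i → sum-mono (f≤g i)

Σ₂-tight : ∀ {f g : Fin n → Fin n → ℕ} → (∀ i j → f i j ≤ g i j) → Σ₂ g ≡ Σ₂ f → ∀ i j → f i j ≡ g i j
Σ₂-tight f≤g g≡f i = sum-tight (f≤g i) (sym (sum-tight (λ i → sum-mono (f≤g i)) g≡f i))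

Σ₂-cong : ∀ {f g : Fin n → Fin n → ℕ} → (∀ i j → f i j ≡ g i j) → Σ₂ f ≡ Σ₂ g
Σ₂-cong f≡g = sum-cong-≗ λ i → sum-cong-≗ (f≡g i)

Σ₂-+ : ∀ (f g : Fin n → Fin n → ℕ) → Σ₂ (λ i j → f i j + g i j) ≡ Σ₂ f + Σ₂ g
Σ₂-+ f g = trans (sum-cong-≗ λ i → ∑-distrib-+ (f i) (g i)) (∑-distrib-+ (sum ∘ f) (sum ∘ g))

Σ₂-* : ∀ (f g : Fin n → ℕ) → Σ₂ (λ i j → f i * g j) ≡ sum f * sum g
Σ₂-* f g = trans (sum-cong-≗ λ i → sym (*-distribˡ-sum (f i) g)) (sym (*-distribʳ-sum (sum g) f))

module _ {A : Set} {P : Pred A ℓ} (P? : Decidable₁ P) where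

  length-filter-tabulate : ∀ (f : Fin n → A) →
    length (filter P? (List.tabulate f)) ≡ sum (λ i → 𝟙 (P? (f i)))
  length-filter-tabulate {zero}  f = refl
  length-filter-tabulate {suc n} f with does (P? (f zero))
  ... | true  = cong suc (length-filter-tabulate (f ∘ suc))
  ... | false = length-filter-tabulate (f ∘ suc)

module _ {A B : Set} {P : Pred (A × B) ℓ} (P? : Decidable₁ P) where

  length-filter-product : ∀ (f : Fin m → A) (g : Fin n → B) →
    length (filter P? (cartesianProduct (List.tabulate f) (List.tabulate g))) ≡
    sum (λ i → sum λ j → 𝟙 (P? (f i , g j)))
  length-filter-product {zero}  f g = refl
  length-filter-product {suc m} f g = begin
    length (filter P? (row List.++ rest))                     ≡⟨ cong length (filter-++ P? row rest) ⟩
    length (filter P? row List.++ filter P? rest)             ≡⟨ length-++ (filter P? row) ⟩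
    length (filter P? row) + length (filter P? rest)
      ≡⟨ cong₂ _+_
           (trans (cong (length ∘ filter P?) (map-tabulate g (f zero ,_))) (length-filter-tabulate P? (λ j → f zero , g j)))
           (length-filter-product (f ∘ suc) g) ⟩
    _                                                    ∎
    where
    open ≡-Reasoning
    row  = List.map (f zero ,_) (List.tabulate g)
    rest = cartesianProduct (List.tabulate (f ∘ suc)) (List.tabulate g)

χ : Graph n → Fin n → Fin n → ℕ
χ G u v = 𝟙 (adj? G u v)

χ-sym : ∀ (G : Graph n) u v → χ G u v ≡ χ G v u
χ-sym G u v = 𝟙-cong (adj? G u v) (adj? G v u) (adj-sym G) (adj-sym G)

deg : Graph n → Fin n → ℕ
deg G u = sum (χ G u)

-- The edge list keeps only pairs with `u < v`; adding the transposed indicator restores the whole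
-- adjacency matrix.
handshake : ∀ (G : Graph n) → 2 * ∣E G ∣ ≡ Σ₂ (χ G)
handshake {n} G = begin
  2 * ∣E G ∣               ≡⟨ cong (2 *_) (length-filter-product (λ (u , v) → up? u v) {n} {n} id id) ⟩
  2 * Σ₂ up                ≡⟨ cong (Σ₂ up +_) (+-identityʳ (Σ₂ up)) ⟩
  Σ₂ up + Σ₂ up            ≡⟨ cong (Σ₂ up +_) (∑-comm up) ⟩
  Σ₂ up + Σ₂ (λ u v → up v u) ≡⟨ Σ₂-+ up (λ u v → up v u) ⟨
  Σ₂ (λ u v → up u v + up v u) ≡⟨ Σ₂-cong pointwise ⟩
  Σ₂ (χ G)                 ∎
  where
  open ≡-Reasoning
  up? : ∀ u v → Dec (Data.Fin._<_ u v × Adj G u v)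
  up? u v = (u <? v) ×-dec adj? G u v
  up : Fin n → Fin n → ℕ
  up u v = 𝟙 (up? u v)
  pointwise : ∀ u v → up u v + up v u ≡ χ G u v
  pointwise u v with Fin.<-cmp u v
  ... | tri< u<v _ ¬v<u =
    trans (cong₂ _+_ (𝟙-cong (up? u v) (adj? G u v) proj₂ (u<v ,_)) (𝟙-no (up? v u) (¬v<u ∘ proj₁))) (+-identityʳ _)
  ... | tri≈ _ refl _   =
    trans (cong₂ _+_ (𝟙-no (up? u u) (adj-irrefl G ∘ proj₂)) (𝟙-no (up? u u) (adj-irrefl G ∘ proj₂)))
          (sym (𝟙-no (adj? G u u) (adj-irrefl G)))
  ... | tri> ¬u<v _ v<u =
    cong₂ _+_ (𝟙-no (up? u v) (¬u<v ∘ proj₁))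
              (𝟙-cong (up? v u) (adj? G u v) (adj-sym G ∘ proj₂) (λ uv → v<u , adj-sym G uv))

-- `S` is a vertex cover, so the degree sum over `S` counts each edge once, and once more if both
-- ends lie in `S`. Doubling lets the correction be a sum over ordered pairs, without halving.
degree-sum-cover : ∀ (G : Graph n) {S : Pred (Fin n) ℓ} (S? : Decidable₁ S) →
  (∀ {u v} → ¬ S u → ¬ S v → ¬ Adj G u v) →
  2 * ∣E G ∣ + Σ₂ (λ u v → 𝟙 (S? u) * 𝟙 (S? v) * χ G u v) ≡ 2 * sum (λ u → 𝟙 (S? u) * deg G u)
degree-sum-cover {n} G S? independent = begin
  2 * ∣E G ∣ + Σ₂ in-S                   ≡⟨ cong (_+ Σ₂ in-S) (handshake G) ⟩
  Σ₂ (χ G) + Σ₂ in-S                     ≡⟨ Σ₂-+ (χ G) in-S ⟨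
  Σ₂ (λ u v → χ G u v + in-S u v)        ≡⟨ Σ₂-cong pointwise ⟩
  Σ₂ (λ u v → row u v + row v u)           ≡⟨ Σ₂-+ row (λ u v → row v u) ⟩
  Σ₂ row + Σ₂ (λ u v → row v u)            ≡⟨ cong (Σ₂ row +_) (∑-comm row) ⟨
  Σ₂ row + Σ₂ row
    ≡⟨ cong (λ z → z + z) (sum-cong-≗ λ u → *-distribˡ-sum (𝟙 (S? u)) (χ G u)) ⟨
  D + D                                    ≡⟨ cong (D +_) (+-identityʳ D) ⟨
  2 * D                                    ∎
  where
  open ≡-Reasoning
  in-S row : Fin n → Fin n → ℕ
  in-S u v = 𝟙 (S? u) * 𝟙 (S? v) * χ G u v
  row u v = 𝟙 (S? u) * χ G u v
  D = sum λ u → 𝟙 (S? u) * deg G u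
  pointwise : ∀ u v → χ G u v + in-S u v ≡ row u v + row v u
  pointwise u v rewrite χ-sym G v u with S? u | S? v | adj? G u v
  ... | yes _ | yes _ | yes _ = refl
  ... | yes _ | yes _ | no  _ = refl
  ... | yes _ | no  _ | yes _ = refl
  ... | yes _ | no  _ | no  _ = refl
  ... | no  _ | yes _ | yes _ = refl
  ... | no  _ | yes _ | no  _ = refl
  ... | no ¬u | no ¬v | yes h = ⊥-elim (independent ¬u ¬v h)
  ... | no  _ | no  _ | no  _ = refl

-- The edge bound

TriangleFree : Graph n → Set
TriangleFree G = ∀ {u v w} → Adj G u v → Adj G v w → ¬ Adj G u w

Independent : Graph n → Pred (Fin n) ℓ → Set ℓ
Independent G S = ∀ {u v} → S u → S v → ¬ Adj G u v

sum-𝟙+sum-𝟙¬ : ∀ {P : Pred (Fin n) ℓ} (P? : Decidable₁ P) →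
  sum (λ i → 𝟙 (P? i)) + sum (λ i → 𝟙 (¬? (P? i))) ≡ n
sum-𝟙+sum-𝟙¬ {n} P? = begin
  sum (λ i → 𝟙 (P? i)) + sum (λ i → 𝟙 (¬? (P? i)))   ≡⟨ ∑-distrib-+ (λ i → 𝟙 (P? i)) (λ i → 𝟙 (¬? (P? i))) ⟨
  sum (λ i → 𝟙 (P? i) + 𝟙 (¬? (P? i)))               ≡⟨ sum-cong-≗ (λ i → once (P? i)) ⟩
  sum {n} (λ _ → 1)                                  ≡⟨ sum-1 n ⟩
  n                                                  ∎
  where
  open ≡-Reasoning
  once : ∀ {P : Set ℓ} (p : Dec P) → 𝟙 p + 𝟙 (¬? p) ≡ 1
  once (yes _) = refl
  once (no  _) = refl

private
  cancel-pred : ∀ e p q → e + p ≤ p * q → p + q ≡ suc m → e ≤ m ^ 2 / 4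
  cancel-pred e p zero    le _  = ≤-trans (m+n≤o⇒m≤o e (≤-trans le (≤-reflexive (*-zeroʳ p)))) z≤n
  cancel-pred e p (suc q) le eq with refl ← suc-injective (trans (sym (+-suc p q)) eq) =
    ≤-trans (+-cancelʳ-≤ p e (p * q) (≤-trans le (≤-reflexive (trans (*-suc p q) (+-comm p (p * q)))))) (a*b≤[a+b]²/4 p q)

-- A vertex of `S` has its neighbours on the other side and misses at least one vertex there, so its
-- degree is at most `q - 1`. Summing over `S` counts every edge once and gives `p * (q - 1)`, a
-- product whose factors add up to `m`.
bipartite-bound : ∀ (G : Graph (suc m)) {S : Pred (Fin (suc m)) ℓ} (S? : Decidable₁ S) →
  Independent G S → Independent G (¬_ ∘ S) →
  (∀ {u} → S u → ∃ λ w → ¬ S w × ¬ Adj G u w) →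
  ∣E G ∣ ≤ m ^ 2 / 4
bipartite-bound {m} G {S} S? indS ind¬S missing =
  cancel-pred ∣E G ∣ p q (subst (λ z → z + p ≤ p * q) (sym e≡D) D+p≤p*q) (sum-𝟙+sum-𝟙¬ S?)
  where
  N = suc m
  σ τ : Fin N → ℕ
  σ u = 𝟙 (S? u)
  τ u = 𝟙 (¬? (S? u))
  p = sum σ
  q = sum τ
  D = sum λ u → σ u * deg G u
  no-inside : ∀ u v → σ u * σ v * χ G u v ≡ 0
  no-inside u v with S? u | S? v
  ... | yes su | yes sv = cong (_+ 0) (𝟙-no (adj? G u v) (indS su sv))
  ... | yes _  | no _   = refl
  ... | no _   | _      = refl
  Σ₂0 : Σ₂ {N} (λ _ _ → 0) ≡ 0
  Σ₂0 = trans (sum-cong-≗ {N} λ _ → sum-replicate-zero N) (sum-replicate-zero N)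
  e≡D : ∣E G ∣ ≡ D
  e≡D = *-cancelˡ-≡ ∣E G ∣ D 2 (begin
    2 * ∣E G ∣                                          ≡⟨ +-identityʳ _ ⟨
    2 * ∣E G ∣ + 0                                      ≡⟨ cong (2 * ∣E G ∣ +_) (trans (Σ₂-cong no-inside) Σ₂0) ⟨
    2 * ∣E G ∣ + Σ₂ (λ u v → σ u * σ v * χ G u v)       ≡⟨ degree-sum-cover G S? ind¬S ⟩
    2 * D                                               ∎)
    where open ≡-Reasoning
  deg<q : ∀ {u} → S u → deg G u + 1 ≤ q
  deg<q {u} su with w , ¬sw , ¬uw ← missing su = begin
    deg G u + 1                            ≡⟨ cong (deg G u +_) (sum-𝟙≟ w) ⟨
    deg G u + sum (λ v → 𝟙 (v ≟ w))        ≡⟨ ∑-distrib-+ (χ G u) (λ v → 𝟙 (v ≟ w)) ⟨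
    sum (λ v → χ G u v + 𝟙 (v ≟ w))        ≤⟨ sum-mono pointwise ⟩
    q                                      ∎
    where
    open ≤-Reasoning
    pointwise : ∀ v → χ G u v + 𝟙 (v ≟ w) ≤ τ v
    pointwise v with v ≟ w
    ... | yes refl = ≤-reflexive (trans (cong (_+ 1) (𝟙-no (adj? G u v) ¬uw)) (sym (𝟙-yes (¬? (S? v)) ¬sw)))
    ... | no _ with adj? G u v
    ...   | yes uv = ≤-reflexive (sym (𝟙-yes (¬? (S? v)) λ sv → indS su sv uv))
    ...   | no  _  = z≤n
  D+p≤p*q : D + p ≤ p * q
  D+p≤p*q = begin
    D + p                                  ≡⟨ ∑-distrib-+ (λ u → σ u * deg G u) σ ⟨
    sum (λ u → σ u * deg G u + σ u)        ≤⟨ sum-mono pointwise ⟩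
    sum (λ u → σ u * q)                    ≡⟨ *-distribʳ-sum q σ ⟨
    p * q                                  ∎
    where
    open ≤-Reasoning
    pointwise : ∀ u → σ u * deg G u + σ u ≤ σ u * q
    pointwise u with S? u
    ... | no _   = z≤n
    ... | yes su = subst₂ _≤_ (cong (_+ 1) (sym (*-identityˡ _))) (sym (*-identityˡ q)) (deg<q su)

argmax : ∀ (f : Fin (suc m) → ℕ) → ∃ λ v → ∀ u → f u ≤ f v
argmax {zero}  f = zero , λ where zero → ≤-refl
argmax {suc m} f with v , max ← argmax (f ∘ suc) with ≤-total (f zero) (f (suc v))
... | inj₁ 0≤v = suc v , λ where zero → 0≤v; (suc u) → max u
... | inj₂ v≤0 = zero , λ where zero → ≤-refl; (suc u) → ≤-trans (max u) v≤0

-- The counting argument with the graph stripped away: `e` is the number of edges, `T` twice the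
-- number inside `S`, `D` the degree sum over `S`, and `d`, `t` are the degree sums of the two ends
-- of xy, in the whole graph and within `S`. Terms to be subtracted are moved across to stay in ℕ.
module Arithmetic {e T D Δ s d t K : ℕ}
  (count : 2 * e + T ≡ 2 * D)
  (I   : D + 2 * Δ ≤ suc s * Δ + d)
  (II  : d ≤ Δ + t)
  (III : t + t ≤ T + 2)
  where

  e≤sΔ+1 : e ≤ s * Δ + 1
  -- `I` and `II` enter with weight two and `III` with weight one; `r` collects the terms that occur
  -- on both sides.
  e≤sΔ+1 = *-cancelˡ-≤ 2 (+-cancelʳ-≤ r _ _ (begin
    2 * e + r                                                   ≡⟨ l e T Δ d t ⟩
    2 * e + T + (4 * Δ + 2 * d + (t + t))                       ≡⟨ cong (_+ (4 * Δ + 2 * d + (t + t))) count ⟩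
    2 * D + (4 * Δ + 2 * d + (t + t))                           ≡⟨ l₂ D Δ d t ⟩
    2 * (D + 2 * Δ) + (2 * d + (t + t))
      ≤⟨ +-mono-≤ (*-monoʳ-≤ 2 I) (+-mono-≤ (*-monoʳ-≤ 2 II) III) ⟩
    2 * (suc s * Δ + d) + (2 * (Δ + t) + (T + 2))               ≡⟨ l₃ s Δ d t T ⟩
    2 * (s * Δ + 1) + r                                         ∎))
    where
    open ≤-Reasoning
    r = T + 4 * Δ + 2 * d + (t + t)
    l : ∀ e T Δ d t → 2 * e + (T + 4 * Δ + 2 * d + (t + t)) ≡ 2 * e + T + (4 * Δ + 2 * d + (t + t))
    l = solve-∀
    l₂ : ∀ D Δ d t → 2 * D + (4 * Δ + 2 * d + (t + t)) ≡ 2 * (D + 2 * Δ) + (2 * d + (t + t))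
    l₂ = solve-∀
    l₃ : ∀ s Δ d t T → 2 * (suc s * Δ + d) + (2 * (Δ + t) + (T + 2)) ≡ 2 * (s * Δ + 1) + (T + 4 * Δ + 2 * d + (t + t))
    l₃ = solve-∀

  module _ (sΔ≤K : s * Δ ≤ K) (K<e : K + 1 ≤ e) where

    private
      -- The lower bound on `e` reverses the weighted sum of the four inequalities, so they can be
      -- peeled off one after another as equalities.
      all-tight = tight (*-monoʳ-≤ 2 sΔ≤K) (+-mono-≤ (*-monoʳ-≤ 2 I) (+-mono-≤ (*-monoʳ-≤ 2 II) III)) (begin
        2 * K + (2 * (suc s * Δ + d) + (2 * (Δ + t) + (T + 2)))     ≡⟨ l K s Δ d t T ⟩
        2 * (K + 1) + T + (4 * Δ + 2 * d + (t + t) + 2 * (s * Δ))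
          ≤⟨ +-monoˡ-≤ (4 * Δ + 2 * d + (t + t) + 2 * (s * Δ)) (+-monoˡ-≤ T (*-monoʳ-≤ 2 K<e)) ⟩
        2 * e + T + (4 * Δ + 2 * d + (t + t) + 2 * (s * Δ))
          ≡⟨ cong (_+ (4 * Δ + 2 * d + (t + t) + 2 * (s * Δ))) count ⟩
        2 * D + (4 * Δ + 2 * d + (t + t) + 2 * (s * Δ))             ≡⟨ l₂ D s Δ d t ⟩
        2 * (s * Δ) + (2 * (D + 2 * Δ) + (2 * d + (t + t)))         ∎)
        where
        open ≤-Reasoning
        l : ∀ K s Δ d t T → 2 * K + (2 * (suc s * Δ + d) + (2 * (Δ + t) + (T + 2))) ≡
            2 * (K + 1) + T + (4 * Δ + 2 * d + (t + t) + 2 * (s * Δ))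
        l = solve-∀
        l₂ : ∀ D s Δ d t → 2 * D + (4 * Δ + 2 * d + (t + t) + 2 * (s * Δ)) ≡ 2 * (s * Δ) + (2 * (D + 2 * Δ) + (2 * d + (t + t)))
        l₂ = solve-∀
      rest = tight (*-monoʳ-≤ 2 I) (+-mono-≤ (*-monoʳ-≤ 2 II) III) (≤-reflexive (sym (proj₂ all-tight)))
      rest₂ = tight (*-monoʳ-≤ 2 II) III (≤-reflexive (sym (proj₂ rest)))

    sΔ≡K : s * Δ ≡ K
    sΔ≡K = *-cancelˡ-≡ _ _ 2 (proj₁ all-tight)

    tight-I : D + 2 * Δ ≡ suc s * Δ + d
    tight-I = *-cancelˡ-≡ _ _ 2 (proj₁ rest)

    tight-II : d ≡ Δ + t
    tight-II = *-cancelˡ-≡ _ _ 2 (proj₁ rest₂)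

    tight-III : t + t ≡ T + 2
    tight-III = proj₂ rest₂

module MaxDegree (G : Graph (suc m)) (△-free : TriangleFree G)
                 (v : Fin (suc m)) (deg≤Δ : ∀ u → deg G u ≤ deg G v) where

  Δ = deg G v

  S : Pred (Fin (suc m)) 0ℓ
  S u = ¬ Adj G v u

  S? : Decidable₁ S
  S? u = ¬? (adj? G v u)

  ¬S⇒N : ∀ {u} → ¬ S u → Adj G v u
  ¬S⇒N {u} = decidable-stable (adj? G v u)

  ind-N : Independent G (¬_ ∘ S)
  ind-N ¬su ¬sw uw = △-free (¬S⇒N ¬su) uw (¬S⇒N ¬sw)

  σ : Fin (suc m) → ℕ
  σ u = 𝟙 (S? u)

  Δ+∣S∣ : Δ + sum σ ≡ suc m
  Δ+∣S∣ = sum-𝟙+sum-𝟙¬ (adj? G v)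

  private
    -- `v` is not its own neighbour and so lies in `S`. Writing the size of `S` as a successor
    -- yields factors `s` and `Δ` with sum `m`.
    S-split : ∃ λ s → suc s ≡ sum σ
    S-split = m≤n⇒∃[o]m+o≡n (≤-trans (≤-reflexive (sym (sum-𝟙≟ v))) (sum-mono pointwise))
      where
      pointwise : ∀ u → 𝟙 (u ≟ v) ≤ σ u
      pointwise u with u ≟ v
      ... | yes refl = ≤-reflexive (sym (𝟙-yes (S? u) (adj-irrefl G)))
      ... | no  _    = z≤n

  s = proj₁ S-split

  ∣S∣≡1+s : sum σ ≡ suc s
  ∣S∣≡1+s = sym (proj₂ S-split)

  s+Δ≡m : s + Δ ≡ m
  s+Δ≡m = suc-injective (trans (cong (_+ Δ) (proj₂ S-split)) (trans (+-comm (sum σ) Δ) Δ+∣S∣))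

  sΔ≤m²/4 : s * Δ ≤ m ^ 2 / 4
  sΔ≤m²/4 = subst (λ z → s * Δ ≤ z ^ 2 / 4) s+Δ≡m (a*b≤[a+b]²/4 s Δ)

  module Edge {x y} (sx : S x) (sy : S y) (xy : Adj G x y) where

    private
      N = suc m

      x≢y : x ≢ y
      x≢y refl = adj-irrefl G xy

      δx δy : Fin N → ℕ
      δx u = 𝟙 (u ≟ x)
      δy u = 𝟙 (u ≟ y)

      lhs₁ rhs₁ lhs₂ rhs₂ : Fin N → ℕ
      lhs₁ u = σ u * deg G u + (δx u + δy u) * Δ
      rhs₁ u = σ u * Δ + (δx u * deg G u + δy u * deg G u)
      lhs₂ u = χ G x u + χ G y u
      rhs₂ u = χ G v u + (σ u * χ G x u + σ u * χ G y u)

      -- `star₃` places the `S`-neighbours of x in row x and those of y in row y; symmetrised, it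
      -- marks the ordered edges inside `S` that touch x or y. `once₃` marks the pair (x, y).
      in₃ once₃ star₃ lhs₃ rhs₃ : Fin N → Fin N → ℕ
      in₃ u w   = σ u * σ w * χ G u w
      once₃ u w = δx u * δy w
      star₃ u w = δx u * (σ w * χ G x w) + δy u * (σ w * χ G y w)
      lhs₃ u w  = star₃ u w + star₃ w u
      rhs₃ u w  = in₃ u w + (once₃ u w + once₃ w u)

      D = sum λ u → σ u * deg G u
      T = Σ₂ in₃
      d = deg G x + deg G y
      t = sum (λ u → σ u * χ G x u) + sum (λ u → σ u * χ G y u)

      -- Both sides agree at `x` and `y`, whose true degrees are kept; elsewhere the maximality of
      -- `Δ` applies.
      le₁ : ∀ u → lhs₁ u ≤ rhs₁ u
      le₁ u with u ≟ x | u ≟ y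
      ... | yes refl | yes refl = ⊥-elim (x≢y refl)
      ... | yes refl | no _ rewrite 𝟙-yes (S? x) sx = ≤-reflexive (l (deg G x) Δ)
        where
        l : ∀ a b → 1 * a + (1 + 0) * b ≡ 1 * b + (1 * a + 0 * a)
        l = solve-∀
      ... | no _ | yes refl rewrite 𝟙-yes (S? y) sy = ≤-reflexive (l (deg G y) Δ)
        where
        l : ∀ a b → 1 * a + (0 + 1) * b ≡ 1 * b + (0 * a + 1 * a)
        l = solve-∀
      ... | no _ | no _ = +-monoˡ-≤ 0 (*-monoʳ-≤ (σ u) (deg≤Δ u))

      sum₁ˡ : sum lhs₁ ≡ D + 2 * Δ
      sum₁ˡ = begin
        sum lhs₁
          ≡⟨ ∑-distrib-+ (λ u → σ u * deg G u) (λ u → (δx u + δy u) * Δ) ⟩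
        D + sum (λ u → (δx u + δy u) * Δ)               ≡⟨ cong (D +_) (*-distribʳ-sum Δ (λ u → δx u + δy u)) ⟨
        D + sum (λ u → δx u + δy u) * Δ                 ≡⟨ cong (λ z → D + z * Δ) (∑-distrib-+ δx δy) ⟩
        D + (sum δx + sum δy) * Δ                       ≡⟨ cong₂ (λ a b → D + (a + b) * Δ) (sum-𝟙≟ x) (sum-𝟙≟ y) ⟩
        D + 2 * Δ                                       ∎
        where open ≡-Reasoning

      sum₁ʳ : sum rhs₁ ≡ suc s * Δ + d
      sum₁ʳ = begin
        sum rhs₁
          ≡⟨ ∑-distrib-+ (λ u → σ u * Δ) (λ u → δx u * deg G u + δy u * deg G u) ⟩
        sum (λ u → σ u * Δ) + sum (λ u → δx u * deg G u + δy u * deg G u)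
          ≡⟨ cong₂ _+_ (sym (*-distribʳ-sum Δ σ)) (∑-distrib-+ (λ u → δx u * deg G u) (λ u → δy u * deg G u)) ⟩
        sum σ * Δ + (sum (λ u → δx u * deg G u) + sum (λ u → δy u * deg G u))
          ≡⟨ cong₂ (λ a b → a * Δ + b) ∣S∣≡1+s (cong₂ _+_ (sum-δ x (deg G)) (sum-δ y (deg G))) ⟩
        suc s * Δ + d                                   ∎
        where open ≡-Reasoning

      -- A vertex of N is adjacent to at most one of x and y, as G has no triangle.
      le₂ : ∀ u → lhs₂ u ≤ rhs₂ u
      le₂ u with adj? G v u | adj? G x u | adj? G y u
      ... | yes _ | yes xu | yes yu = ⊥-elim (△-free xy yu xu)
      ... | yes _ | yes _  | no  _  = ≤-refl
      ... | yes _ | no  _  | yes _  = ≤-refl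
      ... | yes _ | no  _  | no  _  = z≤n
      ... | no  _ | yes _  | yes _  = ≤-refl
      ... | no  _ | yes _  | no  _  = ≤-refl
      ... | no  _ | no  _  | yes _  = ≤-refl
      ... | no  _ | no  _  | no  _  = z≤n

      sum₂ˡ : sum lhs₂ ≡ d
      sum₂ˡ = ∑-distrib-+ (χ G x) (χ G y)

      sum₂ʳ : sum rhs₂ ≡ Δ + t
      sum₂ʳ = trans (∑-distrib-+ (χ G v) (λ u → σ u * χ G x u + σ u * χ G y u))
                    (cong (Δ +_) (∑-distrib-+ (λ u → σ u * χ G x u) (λ u → σ u * χ G y u)))

      -- The symmetrised stars overlap only at (x, y) and (y, x). There the left side is 2, which
      -- `once₃` pays for; at any other pair it is at most the indicator of an edge inside `S`.
      le₃ : ∀ u w → lhs₃ u w ≤ rhs₃ u w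
      le₃ u w with u ≟ x | u ≟ y | w ≟ x | w ≟ y
      ... | yes refl | yes refl | _ | _ = ⊥-elim (x≢y refl)
      ... | _ | _ | yes refl | yes refl = ⊥-elim (x≢y refl)
      ... | yes refl | no _ | yes refl | no _ rewrite 𝟙-yes (S? x) sx | 𝟙-no (adj? G x x) (adj-irrefl G) = z≤n
      ... | no _ | yes refl | no _ | yes refl rewrite 𝟙-yes (S? y) sy | 𝟙-no (adj? G y y) (adj-irrefl G) = z≤n
      ... | yes refl | no _ | no _ | yes refl
        rewrite 𝟙-yes (S? x) sx | 𝟙-yes (S? y) sy | 𝟙-yes (adj? G x y) xy | 𝟙-yes (adj? G y x) (adj-sym G xy) = ≤-refl
      ... | no _ | yes refl | yes refl | no _
        rewrite 𝟙-yes (S? x) sx | 𝟙-yes (S? y) sy | 𝟙-yes (adj? G x y) xy | 𝟙-yes (adj? G y x) (adj-sym G xy) = ≤-refl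
      ... | yes refl | no _ | no _ | no _ rewrite 𝟙-yes (S? x) sx = ≤-reflexive (l (σ w) (χ G x w) (χ G y w))
        where
        l : ∀ a b c → 1 * (a * b) + 0 * (a * c) + 0 ≡ 1 * a * b + 0
        l = solve-∀
      ... | no _ | yes refl | no _ | no _ rewrite 𝟙-yes (S? y) sy = ≤-reflexive (l (σ w) (χ G y w))
        where
        l : ∀ a b → 1 * (a * b) + 0 ≡ 1 * a * b + 0
        l = solve-∀
      ... | no _ | no _ | yes refl | no _ rewrite 𝟙-yes (S? x) sx | χ-sym G x u = ≤-reflexive (l (σ u) (χ G u x))
        where
        l : ∀ a b → 1 * (a * b) + 0 ≡ a * 1 * b + 0
        l = solve-∀
      ... | no _ | no _ | no _ | yes refl rewrite 𝟙-yes (S? y) sy | χ-sym G y u = ≤-reflexive (l (σ u) (χ G u y))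
        where
        l : ∀ a b → 1 * (a * b) ≡ a * 1 * b + 0
        l = solve-∀
      ... | no _ | no _ | no _ | no _ = z≤n

      Σ₂-double : ∀ (f : Fin N → Fin N → ℕ) → Σ₂ (λ u w → f u w + f w u) ≡ Σ₂ f + Σ₂ f
      Σ₂-double f = trans (Σ₂-+ f (λ u w → f w u)) (cong (Σ₂ f +_) (sym (∑-comm f)))

      sum₃ˡ : Σ₂ lhs₃ ≡ t + t
      sum₃ˡ = trans (Σ₂-double star₃) (cong (λ z → z + z) (begin
        Σ₂ star₃
          ≡⟨ Σ₂-+ (λ u w → δx u * (σ w * χ G x w)) (λ u w → δy u * (σ w * χ G y w)) ⟩
        Σ₂ (λ u w → δx u * (σ w * χ G x w)) + Σ₂ (λ u w → δy u * (σ w * χ G y w))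
          ≡⟨ cong₂ _+_ (Σ₂-* δx (λ w → σ w * χ G x w)) (Σ₂-* δy (λ w → σ w * χ G y w)) ⟩
        sum δx * sum (λ w → σ w * χ G x w) + sum δy * sum (λ w → σ w * χ G y w)
          ≡⟨ cong₂ _+_ (one x (sum (λ w → σ w * χ G x w))) (one y (sum (λ w → σ w * χ G y w))) ⟩
        t ∎))
        where
        open ≡-Reasoning
        one : ∀ x a → sum (λ u → 𝟙 (u ≟ x)) * a ≡ a
        one x a = trans (cong (_* a) (sum-𝟙≟ x)) (*-identityˡ a)

      sum₃ʳ : Σ₂ rhs₃ ≡ T + 2
      sum₃ʳ = begin
        Σ₂ rhs₃                                          ≡⟨ Σ₂-+ in₃ (λ u w → once₃ u w + once₃ w u) ⟩
        T + Σ₂ (λ u w → once₃ u w + once₃ w u)           ≡⟨ cong (T +_) (Σ₂-double once₃) ⟩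
        T + (Σ₂ once₃ + Σ₂ once₃)                        ≡⟨ cong (λ z → T + (z + z)) (Σ₂-* δx δy) ⟩
        T + (sum δx * sum δy + sum δx * sum δy)
          ≡⟨ cong₂ (λ a b → T + (a * b + a * b)) (sum-𝟙≟ x) (sum-𝟙≟ y) ⟩
        T + 2                                            ∎
        where open ≡-Reasoning

      open Arithmetic {∣E G ∣} {T} {D} {Δ} {s} {d} {t} {m ^ 2 / 4}
        (degree-sum-cover G S? ind-N)
        (subst₂ _≤_ sum₁ˡ sum₁ʳ (sum-mono le₁))
        (subst₂ _≤_ sum₂ˡ sum₂ʳ (sum-mono le₂))
        (subst₂ _≤_ sum₃ˡ sum₃ʳ (Σ₂-mono le₃))

    edge-bound : ∣E G ∣ ≤ m ^ 2 / 4 + 1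
    edge-bound = ≤-trans e≤sΔ+1 (+-monoˡ-≤ 1 sΔ≤m²/4)

    module Tight (max : m ^ 2 / 4 + 1 ≤ ∣E G ∣) where

      sΔ≡m²/4 : s * Δ ≡ m ^ 2 / 4
      sΔ≡m²/4 = sΔ≡K sΔ≤m²/4 max

      private
        eq₁ : ∀ u → lhs₁ u ≡ rhs₁ u
        eq₁ = sum-tight le₁ (trans sum₁ʳ (trans (sym (tight-I sΔ≤m²/4 max)) (sym sum₁ˡ)))

        eq₂ : ∀ u → lhs₂ u ≡ rhs₂ u
        eq₂ = sum-tight le₂ (trans sum₂ʳ (trans (sym (tight-II sΔ≤m²/4 max)) (sym sum₂ˡ)))

        eq₃ : ∀ u w → lhs₃ u w ≡ rhs₃ u w
        eq₃ = Σ₂-tight le₃ (trans sum₃ʳ (trans (sym (tight-III sΔ≤m²/4 max)) (sym sum₃ˡ)))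

      deg≡Δ : ∀ {u} → S u → u ≢ x → u ≢ y → deg G u ≡ Δ
      deg≡Δ {u} su u≢x u≢y = go (eq₁ u)
        where
        go : lhs₁ u ≡ rhs₁ u → deg G u ≡ Δ
        go eq rewrite 𝟙-yes (S? u) su | 𝟙-no (u ≟ x) u≢x | 𝟙-no (u ≟ y) u≢y =
          trans (l₁ (deg G u)) (trans eq (l₂ Δ))
          where
          l₁ : ∀ a → a ≡ 1 * a + 0
          l₁ = solve-∀
          l₂ : ∀ a → 1 * a + 0 ≡ a
          l₂ = solve-∀

      -- A vertex of N seeing neither end would make `le₂` strict: 0 on the left against 1 on the
      -- right.
      x∨y : ∀ {u} → Adj G v u → Adj G x u ⊎ Adj G y u
      x∨y {u} vu with adj? G x u in eqx | adj? G y u in eqy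
      ... | yes xu | _      = inj₁ xu
      ... | no _   | yes yu = inj₂ yu
      ... | no ¬xu | no ¬yu = ⊥-elim (go (eq₂ u))
        where
        go : lhs₂ u ≢ rhs₂ u
        go eq rewrite 𝟙-yes (adj? G v u) vu | 𝟙-no (adj? G x u) ¬xu | 𝟙-no (adj? G y u) ¬yu = case eq of λ ()

      -- An edge inside `S` that avoids both ends contributes to `rhs₃` but not to `lhs₃`.
      rest-independent : ∀ {u w} → S u → S w → u ≢ x → u ≢ y → w ≢ x → w ≢ y → ¬ Adj G u w
      rest-independent {u} {w} su sw u≢x u≢y w≢x w≢y uw = go (eq₃ u w)
        where
        go : lhs₃ u w ≢ rhs₃ u w
        go eq rewrite 𝟙-yes (S? u) su | 𝟙-yes (S? w) sw | 𝟙-no (u ≟ x) u≢x | 𝟙-no (u ≟ y) u≢y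
                    | 𝟙-no (w ≟ x) w≢x | 𝟙-no (w ≟ y) w≢y | 𝟙-yes (adj? G u w) uw = case eq of λ ()

-- Blow-ups of the 5-cycle

next : Fin 5 → Fin 5
next 0F = 1F
next 1F = 2F
next 2F = 3F
next 3F = 4F
next 4F = 0F

infix 4 _~_ _~?_ _≈_

_~_ : Fin 5 → Fin 5 → Set
i ~ j = j ≡ next i ⊎ i ≡ next j

_~?_ : Decidable _~_
i ~? j = (j ≟ next i) ⊎-dec (i ≟ next j)

~-triangle-free : ∀ i j k → i ~ j → j ~ k → ¬ i ~ k
~-triangle-free = toWitness {a? = all? λ i → all? λ j → all? λ k → (i ~? j) →-dec ((j ~? k) →-dec ¬? (i ~? k))} _

~-nonadjacent : ∀ i j → ¬ i ~ j → j ≡ i ⊎ j ≡ next (next i) ⊎ i ≡ next (next j)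
~-nonadjacent = toWitness {a? = all? λ i → all? λ j → ¬? (i ~? j) →-dec
  ((j ≟ i) ⊎-dec ((j ≟ next (next i)) ⊎-dec (i ≟ next (next j))))} _

-- The vertex of the pentagon that faces the edge from `i` to `next i`.
opposite : Fin 5 → Fin 5
opposite i = next (next (next i))

opposite-unique : ∀ i k → ¬ i ~ k → ¬ k ~ next i → k ≡ opposite i
opposite-unique = toWitness {a? = all? λ i → all? λ k → ¬? (i ~? k) →-dec (¬? (k ~? next i) →-dec (k ≟ opposite i))} _

opposite-far : ∀ i j → i ~ j → ∃ λ k → (k ≢ i × k ≢ j) × ¬ i ~ k × ¬ k ~ j
opposite-far = toWitness {a? = all? λ i → all? λ j → (i ~? j) →-dec any? λ k →
  (¬? (k ≟ i) ×-dec ¬? (k ≟ j)) ×-dec (¬? (i ~? k) ×-dec ¬? (k ~? j))} _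

κ : Fin 5 → Fin 5 → ℕ
κ k i = 𝟙 (i ≟ k)

-- Indicators of the two sides A and B of the Turán graph; class 0F, the new vertex, belongs to
-- neither.
α β : Fin 5 → ℕ
α i = κ 1F i + κ 3F i
β i = κ 2F i + κ 4F i

-- The five classes of a blow-up of the 5-cycle, in cyclic order: 0F is {a₂}, 1F is {a₁}, 2F is B″,
-- 3F is A ∖ {a₁} and 4F is B′.
record Roles (m : ℕ) : Set where
  field
    role  : Fin (suc m) → Fin 5
    v₀ v₁ : Fin (suc m)
    v₀-unique : ∀ u → role u ≡ 0F ⇔ u ≡ v₀
    v₁-unique : ∀ u → role u ≡ 1F ⇔ u ≡ v₁
    b′ : ∃ λ u → role u ≡ 4F
    b″ : ∃ λ u → role u ≡ 2F
    -- Encodes the Turán sizes: the sides have `m` vertices together, so their product reaches this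
    -- value exactly when they are the two halves of `m`.
    balanced : sum (α ∘ role) * sum (β ∘ role) ≡ m ^ 2 / 4

  role-v₀ : role v₀ ≡ 0F
  role-v₀ = from (v₀-unique v₀) refl

  role-v₁ : role v₁ ≡ 1F
  role-v₁ = from (v₁-unique v₁) refl

  ∣class∣ : Fin 5 → ℕ
  ∣class∣ k = sum (κ k ∘ role)

  ∣class-0∣ : ∣class∣ 0F ≡ 1
  ∣class-0∣ = trans (sum-cong-≗ λ u → 𝟙-cong (role u ≟ 0F) (u ≟ v₀) (to (v₀-unique u)) (from (v₀-unique u))) (sum-𝟙≟ v₀)

  ∣class-1∣ : ∣class∣ 1F ≡ 1
  ∣class-1∣ = trans (sum-cong-≗ λ u → 𝟙-cong (role u ≟ 1F) (u ≟ v₁) (to (v₁-unique u)) (from (v₁-unique u))) (sum-𝟙≟ v₁)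

  sum-α : sum (α ∘ role) ≡ suc (∣class∣ 3F)
  sum-α = trans (∑-distrib-+ (κ 1F ∘ role) (κ 3F ∘ role)) (cong (_+ ∣class∣ 3F) ∣class-1∣)

  ∣α∣+∣β∣ : sum (α ∘ role) + sum (β ∘ role) ≡ m
  ∣α∣+∣β∣ = suc-injective (begin
    suc (sum (α ∘ role) + sum (β ∘ role))              ≡⟨ cong₂ _+_ ∣class-0∣ (∑-distrib-+ (α ∘ role) (β ∘ role)) ⟨
    ∣class∣ 0F + sum (λ u → α (role u) + β (role u))
      ≡⟨ ∑-distrib-+ (κ 0F ∘ role) (λ u → α (role u) + β (role u)) ⟨
    sum (λ u → κ 0F (role u) + (α (role u) + β (role u))) ≡⟨ sum-cong-≗ (λ u → partition (role u)) ⟩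
    sum {suc m} (λ _ → 1)                              ≡⟨ sum-1 (suc m) ⟩
    suc m                                              ∎)
    where
    open ≡-Reasoning
    partition : ∀ i → κ 0F i + (α i + β i) ≡ 1
    partition = toWitness {a? = all? λ i → κ 0F i + (α i + β i) Nat.≟ 1} _

  -- Only class 3F has no witness among the fields. Both halves of `m` are at least 2, so the side
  -- of `v₁` contains a further vertex, and its class is 3F.
  inhabited : 4 ≤ m → ∀ i → ∃ λ u → role u ≡ i
  inhabited _   0F = v₀ , role-v₀
  inhabited _   1F = v₁ , role-v₁
  inhabited _   2F = b″
  inhabited _   4F = b′
  inhabited 4≤m 3F with any? (λ u → role u ≟ 3F)
  ... | yes c = c
  ... | no ¬c = ⊥-elim (1+n≰n 2≤1)
    where
    2≤sum-α : 2 ≤ sum (α ∘ role)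
    2≤sum-α with a*b≡[a+b]²/4⇒halves _ _ (trans balanced (cong (λ z → z ^ 2 / 4) (sym ∣α∣+∣β∣)))
    ... | inj₁ (e , _) = subst (2 ≤_) (sym (trans e (cong ⌊_/2⌋ ∣α∣+∣β∣))) (⌊n/2⌋-mono 4≤m)
    ... | inj₂ (e , _) = subst (2 ≤_) (sym (trans e (cong ⌈_/2⌉ ∣α∣+∣β∣))) (⌈n/2⌉-mono 4≤m)
    2≤1 : 2 ≤ 1
    2≤1 = subst (2 ≤_) (trans sum-α (cong suc ∣class-3∣)) 2≤sum-α
      where
      ∣class-3∣ : ∣class∣ 3F ≡ 0
      ∣class-3∣ = trans (sum-cong-≗ λ u → 𝟙-no (role u ≟ 3F) (λ e → ¬c (u , e))) (sum-replicate-zero (suc m))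

open Roles

blowup : Roles m → Graph (suc m)
blowup r = record
  { Adj        = λ u v → role r u ~ role r v
  ; adj?       = λ u v → role r u ~? role r v
  ; adj-sym    = λ where (inj₁ e) → inj₂ e; (inj₂ e) → inj₁ e
  ; adj-irrefl = λ {u} → irrefl (role r u)
  }
  where
  irrefl : ∀ i → ¬ i ~ i
  irrefl = toWitness {a? = all? λ i → ¬? (i ~? i)} _

blowup-triangle-free : ∀ (r : Roles m) → TriangleFree (blowup r)
blowup-triangle-free r = ~-triangle-free _ _ _

-- Propositional equality of graphs would also compare decision procedures and proofs; only
-- adjacency matters.
_≈_ : Graph n → Graph n → Set
G ≈ H = ∀ {u v} → Adj G u v ⇔ Adj H u v

∣E∣-cong : ∀ {G H : Graph n} → G ≈ H → ∣E G ∣ ≡ ∣E H ∣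
∣E∣-cong {G = G} {H} G≈H = *-cancelˡ-≡ _ _ 2 (begin
  2 * ∣E G ∣    ≡⟨ handshake G ⟩
  Σ₂ (χ G)      ≡⟨ Σ₂-cong (λ u v → 𝟙-cong (adj? G u v) (adj? H u v) (to G≈H) (from G≈H)) ⟩
  Σ₂ (χ H)      ≡⟨ handshake H ⟨
  2 * ∣E H ∣    ∎)
  where open ≡-Reasoning

-- Compares the 5-cycle with the complete bipartite graph between 1F, 3F and 2F, 4F: the edges
-- from 1F to 4F are traded for those at 0F.
cycle-count : ∀ i j →
  𝟙 (i ~? j) + (κ 1F i * κ 4F j + κ 4F i * κ 1F j) ≡
  (α i * β j + β i * α j) + (κ 0F i * (κ 1F j + κ 4F j) + (κ 1F i + κ 4F i) * κ 0F j)
cycle-count = toWitness {a? = all? λ i → all? λ j → _ Nat.≟ _} _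

-- The bipartite graph between the sides has `p * q` edges. It loses `c₄` of them, class 1F being a
-- singleton, while class 0F contributes `1 + c₄`; the net gain is 1.
∣E-blowup∣ : ∀ (r : Roles m) → ∣E blowup r ∣ ≡ m ^ 2 / 4 + 1
∣E-blowup∣ {m} r = *-cancelˡ-≡ _ _ 2 (+-cancelʳ-≡ (2 * c₄) _ _ (begin
  2 * ∣E blowup r ∣ + 2 * c₄
    ≡⟨ cong₂ _+_ (handshake (blowup r)) (trans (double c₄) (cong (λ z → z * c₄ + c₄ * z) (sym c₁≡1))) ⟩
  Σ₂ (χ (blowup r)) + (c₁ * c₄ + c₄ * c₁)          ≡⟨ cong (Σ₂ (χ (blowup r)) +_) (Σ₂-*+* f₁ f₄ f₄ f₁) ⟨
  Σ₂ (χ (blowup r)) + Σ₂ traded                    ≡⟨ Σ₂-+ (χ (blowup r)) traded ⟨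
  Σ₂ (λ u v → χ (blowup r) u v + traded u v)       ≡⟨ Σ₂-cong (λ u v → cycle-count (role r u) (role r v)) ⟩
  Σ₂ (λ u v → bipartite u v + at-v₀ u v)           ≡⟨ Σ₂-+ bipartite at-v₀ ⟩
  Σ₂ bipartite + Σ₂ at-v₀                          ≡⟨ cong₂ _+_ (Σ₂-*+* fα fβ fβ fα) (Σ₂-*+* f₀ f₁₄ f₁₄ f₀) ⟩
  (p * q + q * p) + (c₀ * c₁₄ + c₁₄ * c₀)
    ≡⟨ cong₂ (λ a b → (p * q + q * p) + (a * b + b * a)) (∣class-0∣ r) (trans (∑-distrib-+ f₁ f₄) (cong (_+ c₄) c₁≡1)) ⟩
  (p * q + q * p) + (1 * (1 + c₄) + (1 + c₄) * 1)  ≡⟨ arith p q c₄ ⟩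
  2 * (p * q + 1) + 2 * c₄                         ≡⟨ cong (λ z → 2 * (z + 1) + 2 * c₄) (balanced r) ⟩
  2 * (m ^ 2 / 4 + 1) + 2 * c₄                     ∎))
  where
  open ≡-Reasoning
  fα fβ f₀ f₁ f₄ f₁₄ : Fin (suc m) → ℕ
  fα = α ∘ role r
  fβ = β ∘ role r
  f₀ = κ 0F ∘ role r
  f₁ = κ 1F ∘ role r
  f₄ = κ 4F ∘ role r
  f₁₄ u = f₁ u + f₄ u
  traded bipartite at-v₀ : Fin (suc m) → Fin (suc m) → ℕ
  traded u v    = f₁ u * f₄ v + f₄ u * f₁ v
  bipartite u v = fα u * fβ v + fβ u * fα v
  at-v₀ u v     = f₀ u * f₁₄ v + f₁₄ u * f₀ v
  p = sum fα
  q = sum fβ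
  c₀ = ∣class∣ r 0F
  c₁ = ∣class∣ r 1F
  c₄ = ∣class∣ r 4F
  c₁₄ = sum f₁₄
  c₁≡1 = ∣class-1∣ r
  double : ∀ c → 2 * c ≡ 1 * c + c * 1
  double = solve-∀
  arith : ∀ p q c → (p * q + q * p) + (1 * (1 + c) + (1 + c) * 1) ≡ 2 * (p * q + 1) + 2 * c
  arith = solve-∀
  Σ₂-*+* : ∀ (f g h k : Fin (suc m) → ℕ) → Σ₂ (λ u v → f u * g v + h u * k v) ≡ sum f * sum g + sum h * sum k
  Σ₂-*+* f g h k = trans (Σ₂-+ (λ u v → f u * g v) (λ u v → h u * k v)) (cong₂ _+_ (Σ₂-* f g) (Σ₂-* h k))

pull : Fin (suc m) ↔ Fin (suc m) → Roles m → Roles m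
pull φ r = record
  { role      = role r ∘ (φ ⟨$⟩ʳ_)
  ; v₀        = φ ⟨$⟩ˡ v₀ r
  ; v₁        = φ ⟨$⟩ˡ v₁ r
  ; v₀-unique = λ u → mk⇔ (λ e → moved (to (v₀-unique r _) e)) λ where refl → trans (cong (role r) (inverseʳ φ)) (role-v₀ r)
  ; v₁-unique = λ u → mk⇔ (λ e → moved (to (v₁-unique r _) e)) λ where refl → trans (cong (role r) (inverseʳ φ)) (role-v₁ r)
  ; b′        = preimage (b′ r)
  ; b″        = preimage (b″ r)
  ; balanced  = trans (sym (cong₂ _*_ (sum-permute (α ∘ role r) φ) (sum-permute (β ∘ role r) φ))) (balanced r)
  }
  where
  moved : ∀ {u w} → φ ⟨$⟩ʳ u ≡ w → u ≡ φ ⟨$⟩ˡ w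
  moved e = trans (sym (inverseˡ φ)) (cong (φ ⟨$⟩ˡ_) e)
  preimage : ∀ {i} → (∃ λ u → role r u ≡ i) → ∃ λ u → role r (φ ⟨$⟩ʳ u) ≡ i
  preimage (u , e) = φ ⟨$⟩ˡ u , trans (cong (role r) (inverseʳ φ)) e

-- Distance two and complements of blow-ups

distance₂ : ∀ {G : Graph n} {u w v} → u ≢ v → ¬ Adj G u v → Adj G u w → Adj G w v → Distance G 2 u v
distance₂ u≢v ¬uv uw wv = uw ∷ (wv ∷ []) , λ where
  (s≤s z≤n)       []        → u≢v refl
  (s≤s (s≤s z≤n)) (uv ∷ []) → ¬uv uv

midpoint : ∀ {G : Graph n} {u v} → Distance G 2 u v → ∃ λ w → Adj G u w × Adj G w v
midpoint (uw ∷ (wv ∷ []) , _) = _ , uw , wv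

distance₂⇒≢ : ∀ {G : Graph n} {u v} → Distance G 2 u v → u ≢ v
distance₂⇒≢ (_ , shortest) refl = shortest (s≤s z≤n) []

distance₂⇒¬adj : ∀ {G : Graph n} {u v} → Distance G 2 u v → ¬ Adj G u v
distance₂⇒¬adj (_ , shortest) uv = shortest (s≤s (s≤s z≤n)) (uv ∷ [])

-- For an edge of the pentagon, the class facing it is joined in the complement to both end classes,
-- and it is nonempty, so it supplies a midpoint. Conversely, distinct vertices that are not
-- adjacent in the complement are adjacent in the blow-up.
complement-blowup-G₂ : ∀ {G : Graph (suc m)} (r : Roles m) → 4 ≤ m →
  G ≈ complement (blowup r) → distanceGraph 2 G ≈ blowup r
complement-blowup-G₂ {m} {G} r 4≤m G≈ {u} {v} = mk⇔ ⇒ ⇐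
  where
  ⇒ : Distance G 2 u v → role r u ~ role r v
  ⇒ d = decidable-stable (role r u ~? role r v) λ ¬uv → distance₂⇒¬adj d (from G≈ (distance₂⇒≢ d , ¬uv))
  ⇐ : role r u ~ role r v → Distance G 2 u v
  ⇐ uv with k , (k≢i , k≢j) , ¬ik , ¬kj ← opposite-far _ _ uv
       with w , refl ← inhabited r 4≤m k =
    distance₂ {G = G} (λ where refl → adj-irrefl (blowup r) {u} uv)
              (λ a → proj₂ (to G≈ a) uv)
              (from G≈ ((λ where refl → k≢i refl) , ¬ik))
              (from G≈ ((λ where refl → k≢j refl) , ¬kj))

-- A midpoint of an edge of the blow-up lies in the class opposite to it. So the singletons v₀ and v₁
-- are joined in G to all of their opposite classes, which brings the remaining pairs within
-- distance 2.
G₂-blowup-complement : ∀ {G : Graph (suc m)} (r : Roles m) → 4 ≤ m →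
  distanceGraph 2 G ≈ blowup r → G ≈ complement (blowup r)
G₂-blowup-complement {m} {G} r 4≤m G₂≈ {u} {v} = mk⇔ ⇒ ⇐
  where
  c : Fin (suc m) → Fin 5
  c = role r

  adj⇒¬~ : ∀ {u v} → Adj G u v → ¬ c u ~ c v
  adj⇒¬~ uv uv′ = distance₂⇒¬adj (from G₂≈ uv′) uv

  ⇒ : Adj G u v → Adj (complement (blowup r)) u v
  ⇒ uv = (λ where refl → adj-irrefl G uv) , adj⇒¬~ uv

  -- Two distinct vertices with a common neighbour in `G` are adjacent or at distance 2, and
  -- distance 2 would put an edge of the blow-up between them.
  close : ∀ {u w v} → Adj G u w → Adj G w v → u ≢ v → ¬ c u ~ c v → Adj G u v
  close uw wv u≢v ¬uv = decidable-stable (adj? G _ _) λ ¬a → ¬uv (to G₂≈ (distance₂ {G = G} u≢v ¬a uw wv))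

  via-opposite : ∀ {i u v} → c u ≡ i → c v ≡ next i → ∃ λ w → c w ≡ opposite i × Adj G u w × Adj G w v
  via-opposite {u = u} {v} refl e with w , uw , wv ← midpoint (from (G₂≈ {u} {v}) (inj₁ e)) =
    w , opposite-unique _ _ (adj⇒¬~ uw) (λ wv′ → adj⇒¬~ wv (subst (c w ~_) (sym e) wv′)) , uw , wv

  class-2-v₀ : ∀ {u} → c u ≡ 2F → Adj G u (v₀ r)
  class-2-v₀ e with v , e′ ← inhabited r 4≤m 3F
               with w , ew , uw , _ ← via-opposite e e′ = subst (Adj G _) (to (v₀-unique r w) ew) uw

  class-3-v₀ : ∀ {v} → c v ≡ 3F → Adj G v (v₀ r)
  class-3-v₀ e with u , e′ ← inhabited r 4≤m 2F
               with w , ew , _ , wv ← via-opposite e′ e = subst (Adj G _) (to (v₀-unique r w) ew) (adj-sym G wv)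

  class-3-v₁ : ∀ {u} → c u ≡ 3F → Adj G u (v₁ r)
  class-3-v₁ e with v , e′ ← inhabited r 4≤m 4F
               with w , ew , uw , _ ← via-opposite e e′ = subst (Adj G _) (to (v₁-unique r w) ew) uw

  class-4-v₁ : ∀ {v} → c v ≡ 4F → Adj G v (v₁ r)
  class-4-v₁ e with u , e′ ← inhabited r 4≤m 3F
               with w , ew , _ , wv ← via-opposite e′ e = subst (Adj G _) (to (v₁-unique r w) ew) (adj-sym G wv)

  close′ : ∀ {i j u w v} → c u ≡ i → c v ≡ j → ¬ i ~ j → Adj G u w → Adj G v w → u ≢ v → Adj G u v
  close′ refl refl i≁j uw vw u≢v = close uw (adj-sym G vw) u≢v i≁j

  -- No singleton class is joined to both 2F and 4F, so a midpoint `w` of `v₁` and u is used; it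
  -- lies in class 4F. If `w` is not v, the two share the neighbour `v₁` and are adjacent, and then
  -- u and v share `w`.
  class-2-4 : ∀ {u v} → c u ≡ 2F → c v ≡ 4F → Adj G u v
  class-2-4 {u} {v} eu ev with w , ew , v₁w , wu ← via-opposite (role-v₁ r) eu with w ≟ v
  ... | yes refl = adj-sym G wu
  ... | no w≢v   = close′ eu ev (λ where (inj₁ ()); (inj₂ ())) (adj-sym G wu)
    (close′ ev ew (λ where (inj₁ ()); (inj₂ ())) (class-4-v₁ ev) (class-4-v₁ ew) (w≢v ∘ sym))
    (λ where refl → case trans (sym eu) ev of λ ())

  same : ∀ {u v} i → c u ≡ i → c v ≡ i → u ≢ v → Adj G u v
  same 0F eu ev u≢v = ⊥-elim (u≢v (trans (to (v₀-unique r _) eu) (sym (to (v₀-unique r _) ev))))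
  same 1F eu ev u≢v = ⊥-elim (u≢v (trans (to (v₁-unique r _) eu) (sym (to (v₁-unique r _) ev))))
  same 2F eu ev = close′ eu ev (λ where (inj₁ ()); (inj₂ ())) (class-2-v₀ eu) (class-2-v₀ ev)
  same 3F eu ev = close′ eu ev (λ where (inj₁ ()); (inj₂ ())) (class-3-v₀ eu) (class-3-v₀ ev)
  same 4F eu ev = close′ eu ev (λ where (inj₁ ()); (inj₂ ())) (class-4-v₁ eu) (class-4-v₁ ev)

  two-apart : ∀ {u v} i → c u ≡ i → c v ≡ next (next i) → Adj G u v
  two-apart 0F eu ev with refl ← to (v₀-unique r _) eu = adj-sym G (class-2-v₀ ev)
  two-apart 1F eu ev with refl ← to (v₁-unique r _) eu = adj-sym G (class-3-v₁ ev)
  two-apart 2F eu ev = class-2-4 eu ev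
  two-apart 3F eu ev with refl ← to (v₀-unique r _) ev = class-3-v₀ eu
  two-apart 4F eu ev with refl ← to (v₁-unique r _) ev = class-4-v₁ eu

  ⇐ : Adj (complement (blowup r)) u v → Adj G u v
  ⇐ (u≢v , ¬uv) with ~-nonadjacent (c u) (c v) ¬uv
  ... | inj₁ e        = same (c u) refl e u≢v
  ... | inj₂ (inj₁ e) = two-apart (c u) refl e
  ... | inj₂ (inj₂ e) = adj-sym G (two-apart (c v) refl e)

-- The construction as a blow-up

∣p∣≡sum : ∀ (p : Subset n) → ∣ p ∣ ≡ sum (λ i → 𝟙 (i ∈? p))
∣p∣≡sum []            = refl
∣p∣≡sum (inside  ∷ p) = cong suc (∣p∣≡sum p)
∣p∣≡sum (outside ∷ p) = ∣p∣≡sum p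

module _ {P : Pred (Fin n) ℓ} (P? : Decidable₁ P) where

  subset : Subset n
  subset = tabulate (does ∘ P?)

  ∈-subset⁺ : ∀ {i} → P i → i ∈ subset
  ∈-subset⁺ {i} p = lookup⇒[]= i subset (trans (lookup∘tabulate (does ∘ P?) i) (dec-true (P? i) p))

  ∈-subset⁻ : ∀ {i} → i ∈ subset → P i
  ∈-subset⁻ {i} i∈ with P? i | trans (sym (lookup∘tabulate (does ∘ P?) i)) ([]=⇒lookup i∈)
  ... | yes p | _ = p

yes⇔ : ∀ {P : Set} {Q : Set} → P → Q → P ⇔ Q
yes⇔ p q = mk⇔ (λ _ → q) (λ _ → p)

no⇔ : ∀ {P : Set} {Q : Set} → ¬ P → ¬ Q → P ⇔ Q
no⇔ ¬p ¬q = mk⇔ (⊥-elim ∘ ¬p) (⊥-elim ∘ ¬q)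

-- The constructed graph described by properties alone, on any vertex labelling, so that one passage
-- to a blow-up serves both the construction and the extremal graphs. B′ and B″ appear as the parts
-- of `B` seen by `a₂` and by `a₁`.
record NearBipartite (H : Graph (suc m)) : Set₁ where
  field
    a₂ a₁ : Fin (suc m)
    A     : Pred (Fin (suc m)) 0ℓ
    A?    : Decidable₁ A
    a₁∈A  : A a₁
    a₂∉A  : ¬ A a₂

  B : Pred (Fin (suc m)) 0ℓ
  B u = ¬ A u × u ≢ a₂

  B? : Decidable₁ B
  B? u = ¬? (A? u) ×-dec ¬? (u ≟ a₂)

  field
    A-independent : Independent H A
    B-independent : Independent H B
    A-B           : ∀ {u w} → A u → u ≢ a₁ → B w → Adj H u w
    a₂-a₁         : Adj H a₂ a₁
    a₂-A          : ∀ {u} → A u → u ≢ a₁ → ¬ Adj H a₂ u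
    B-split       : ∀ {w} → B w → Adj H a₁ w ⊎ Adj H a₂ w
    B-disjoint    : ∀ {w} → B w → Adj H a₁ w → ¬ Adj H a₂ w
    B′-inhabited  : ∃ λ w → B w × Adj H a₂ w
    B″-inhabited  : ∃ λ w → B w × Adj H a₁ w
    A*B           : sum (λ u → 𝟙 (A? u)) * sum (λ u → 𝟙 (B? u)) ≡ m ^ 2 / 4

  data Kind : Fin (suc m) → Fin 5 → Set where
    is-a₂ : Kind a₂ 0F
    is-a₁ : Kind a₁ 1F
    in-B″ : ∀ {w} → B w → ¬ Adj H a₂ w → Kind w 2F
    in-A  : ∀ {u} → A u → u ≢ a₁ → Kind u 3F
    in-B′ : ∀ {w} → B w → Adj H a₂ w → Kind w 4F

  kind : ∀ u → ∃ (Kind u)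
  kind u with u ≟ a₂ | u ≟ a₁ | A? u | adj? H a₂ u
  ... | yes refl | _        | _     | _     = _ , is-a₂
  ... | no _     | yes refl | _     | _     = _ , is-a₁
  ... | no _     | no ≢a₁   | yes a | _     = _ , in-A a ≢a₁
  ... | no ≢a₂   | no _     | no ¬a | yes h = _ , in-B′ (¬a , ≢a₂) h
  ... | no ≢a₂   | no _     | no ¬a | no ¬h = _ , in-B″ (¬a , ≢a₂) ¬h

  a₁≢a₂ : a₁ ≢ a₂
  a₁≢a₂ e = a₂∉A (subst A e a₁∈A)

  kind-of-a₂ : ∀ {i} → Kind a₂ i → i ≡ 0F
  kind-of-a₂ k = go k refl
    where
    go : ∀ {u i} → Kind u i → u ≡ a₂ → i ≡ 0F
    go is-a₂               _    = refl
    go is-a₁               e    = ⊥-elim (a₁≢a₂ e)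
    go (in-B″ (_ , ≢a₂) _) e    = ⊥-elim (≢a₂ e)
    go (in-A a _)          refl = ⊥-elim (a₂∉A a)
    go (in-B′ (_ , ≢a₂) _) e    = ⊥-elim (≢a₂ e)

  kind-of-a₁ : ∀ {i} → Kind a₁ i → i ≡ 1F
  kind-of-a₁ k = go k refl
    where
    go : ∀ {u i} → Kind u i → u ≡ a₁ → i ≡ 1F
    go is-a₂              e    = ⊥-elim (a₁≢a₂ (sym e))
    go is-a₁              _    = refl
    go (in-B″ (¬a , _) _) refl = ⊥-elim (¬a a₁∈A)
    go (in-A _ ≢a₁)       e    = ⊥-elim (≢a₁ e)
    go (in-B′ (¬a , _) _) refl = ⊥-elim (¬a a₁∈A)

  kind-of-B″ : ∀ {w i} → Kind w i → B w → ¬ Adj H a₂ w → i ≡ 2F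
  kind-of-B″ is-a₂       (_ , ≢a₂) _  = ⊥-elim (≢a₂ refl)
  kind-of-B″ is-a₁       (¬a , _)  _  = ⊥-elim (¬a a₁∈A)
  kind-of-B″ (in-B″ _ _) _         _  = refl
  kind-of-B″ (in-A a _)  (¬a , _)  _  = ⊥-elim (¬a a)
  kind-of-B″ (in-B′ _ h) _         ¬h = ⊥-elim (¬h h)

  kind-of-B′ : ∀ {w i} → Kind w i → B w → Adj H a₂ w → i ≡ 4F
  kind-of-B′ is-a₂        (_ , ≢a₂) _ = ⊥-elim (≢a₂ refl)
  kind-of-B′ is-a₁        (¬a , _)  _ = ⊥-elim (¬a a₁∈A)
  kind-of-B′ (in-B″ _ ¬h) _         h = ⊥-elim (¬h h)
  kind-of-B′ (in-A a _)   (¬a , _)  _ = ⊥-elim (¬a a)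
  kind-of-B′ (in-B′ _ _)  _         _ = refl

  private
    far : ∀ {i j} {f : False (i ~? j)} → ¬ i ~ j
    far {f = f} = toWitnessFalse f

    a₁-B″ : ∀ {w} → B w → ¬ Adj H a₂ w → Adj H a₁ w
    a₁-B″ b ¬h = [ id , ⊥-elim ∘ ¬h ]′ (B-split b)

    flip⇔ : ∀ {u v i j} → Adj H u v ⇔ i ~ j → Adj H v u ⇔ j ~ i
    flip⇔ e = mk⇔ (swap ∘ to e ∘ adj-sym H) (adj-sym H ∘ from e ∘ swap)

  kind-adjacent : ∀ {u v i j} → Kind u i → Kind v j → Adj H u v ⇔ i ~ j
  kind-adjacent is-a₂          is-a₂          = no⇔ (adj-irrefl H) far
  kind-adjacent is-a₂          is-a₁          = yes⇔ a₂-a₁ (inj₁ refl)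
  kind-adjacent is-a₂          (in-B″ _ ¬h)   = no⇔ ¬h far
  kind-adjacent is-a₂          (in-A a ≢a₁)   = no⇔ (a₂-A a ≢a₁) far
  kind-adjacent is-a₂          (in-B′ _ h)    = yes⇔ h (inj₂ refl)
  kind-adjacent is-a₁          is-a₁          = no⇔ (adj-irrefl H) far
  kind-adjacent is-a₁          (in-B″ b ¬h)   = yes⇔ (a₁-B″ b ¬h) (inj₁ refl)
  kind-adjacent is-a₁          (in-A a _)     = no⇔ (A-independent a₁∈A a) far
  kind-adjacent is-a₁          (in-B′ b h)    = no⇔ (λ h′ → B-disjoint b h′ h) far
  kind-adjacent (in-B″ b _)    (in-B″ b′ _)   = no⇔ (B-independent b b′) far
  kind-adjacent (in-B″ b _)    (in-B′ b′ _)   = no⇔ (B-independent b b′) far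
  kind-adjacent (in-A a ≢a₁)   (in-B″ b _)    = yes⇔ (A-B a ≢a₁ b) (inj₂ refl)
  kind-adjacent (in-A a _)     (in-A a′ _)    = no⇔ (A-independent a a′) far
  kind-adjacent (in-A a ≢a₁)   (in-B′ b _)    = yes⇔ (A-B a ≢a₁ b) (inj₁ refl)
  kind-adjacent (in-B′ b _)    (in-B′ b′ _)   = no⇔ (B-independent b b′) far
  kind-adjacent x@is-a₁        y@is-a₂        = flip⇔ (kind-adjacent y x)
  kind-adjacent x@(in-B″ _ _)  y@is-a₂        = flip⇔ (kind-adjacent y x)
  kind-adjacent x@(in-A _ _)   y@is-a₂        = flip⇔ (kind-adjacent y x)
  kind-adjacent x@(in-B′ _ _)  y@is-a₂        = flip⇔ (kind-adjacent y x)
  kind-adjacent x@(in-B″ _ _)  y@is-a₁        = flip⇔ (kind-adjacent y x)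
  kind-adjacent x@(in-A _ _)   y@is-a₁        = flip⇔ (kind-adjacent y x)
  kind-adjacent x@(in-B′ _ _)  y@is-a₁        = flip⇔ (kind-adjacent y x)
  kind-adjacent x@(in-B″ _ _)  y@(in-A _ _)   = flip⇔ (kind-adjacent y x)
  kind-adjacent x@(in-B′ _ _)  y@(in-A _ _)   = flip⇔ (kind-adjacent y x)
  kind-adjacent x@(in-B′ _ _)  y@(in-B″ _ _)  = flip⇔ (kind-adjacent y x)

  private
    kind-α : ∀ {u i} → Kind u i → α i ≡ 𝟙 (A? u)
    kind-α is-a₂              = sym (𝟙-no (A? _) a₂∉A)
    kind-α is-a₁              = sym (𝟙-yes (A? _) a₁∈A)
    kind-α (in-B″ (¬a , _) _) = sym (𝟙-no (A? _) ¬a)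
    kind-α (in-A a _)         = sym (𝟙-yes (A? _) a)
    kind-α (in-B′ (¬a , _) _) = sym (𝟙-no (A? _) ¬a)

    kind-β : ∀ {u i} → Kind u i → β i ≡ 𝟙 (B? u)
    kind-β is-a₂       = sym (𝟙-no (B? _) λ (_ , ≢a₂) → ≢a₂ refl)
    kind-β is-a₁       = sym (𝟙-no (B? _) λ (¬a , _) → ¬a a₁∈A)
    kind-β (in-B″ b _) = sym (𝟙-yes (B? _) b)
    kind-β (in-A a _)  = sym (𝟙-no (B? _) λ (¬a , _) → ¬a a)
    kind-β (in-B′ b _) = sym (𝟙-yes (B? _) b)

  roles : Roles m
  roles = record
    { role      = proj₁ ∘ kind
    ; v₀        = a₂
    ; v₁        = a₁
    ; v₀-unique = λ u → mk⇔ (λ e → only-a₂ (subst (Kind u) e (proj₂ (kind u)))) λ where refl → kind-of-a₂ (proj₂ (kind u))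
    ; v₁-unique = λ u → mk⇔ (λ e → only-a₁ (subst (Kind u) e (proj₂ (kind u)))) λ where refl → kind-of-a₁ (proj₂ (kind u))
    ; b′        = let w , b , h = B′-inhabited in w , kind-of-B′ (proj₂ (kind w)) b h
    ; b″        = let w , b , h = B″-inhabited in w , kind-of-B″ (proj₂ (kind w)) b (B-disjoint b h)
    ; balanced  = trans (cong₂ _*_ (sum-cong-≗ λ u → kind-α (proj₂ (kind u))) (sum-cong-≗ λ u → kind-β (proj₂ (kind u)))) A*B
    }
    where
    only-a₂ : ∀ {u} → Kind u 0F → u ≡ a₂
    only-a₂ is-a₂ = refl
    only-a₁ : ∀ {u} → Kind u 1F → u ≡ a₁
    only-a₁ is-a₁ = refl

  ≈-blowup : H ≈ blowup roles
  ≈-blowup {u} {v} = kind-adjacent (proj₂ (kind u)) (proj₂ (kind v))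

module _ (C : Construction m) where
  open Construction C

  B′⇒∉A : ∀ {j} → j ∈ B′ → j ∉ A
  B′⇒∉A b = x∈∁p⇒x∉p (subst (_ ∈_) cover (x∈p∪q⁺ (inj₁ b)))

  B″⇒∉A : ∀ {j} → j ∈ B″ → j ∉ A
  B″⇒∉A b = x∈∁p⇒x∉p (subst (_ ∈_) cover (x∈p∪q⁺ (inj₂ b)))

  new-adjacent : ∀ {j} → j ≢ a₁ → j ∈ ⁅ a₁ ⁆ ∪ B′ → j ∈ B′
  new-adjacent ≢a₁ j∈ with x∈p∪q⁻ ⁅ a₁ ⁆ B′ j∈
  ... | inj₁ j∈a₁ = ⊥-elim (≢a₁ (x∈⁅y⁆⇒x≡y a₁ j∈a₁))
  ... | inj₂ j∈B′ = j∈B′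

  private
    Old : Pred (Fin (suc m)) 0ℓ
    Old zero    = ⊥
    Old (suc j) = j ∈ A

    old? : Decidable₁ Old
    old? zero    = no λ ()
    old? (suc j) = j ∈? A

    across : ∀ {u v} → u ∈ A → v ∉ A → u ≢ a₁ ⊎ v ∉ B′ → Adj graph (suc u) (suc v)
    across u∈A v∉A kept = inj₁ (u∈A , v∉A) ,
      (λ (u≡a₁ , v∈B′) → [ (λ u≢a₁ → u≢a₁ u≡a₁) , (λ v∉B′ → v∉B′ v∈B′) ]′ kept) ,
      (λ (v≡a₁ , _) → v∉A (subst (_∈ A) (sym v≡a₁) a₁∈A))

    ∉A⇒≢a₁ : ∀ {j} → j ∉ A → j ≢ a₁
    ∉A⇒≢a₁ j∉A refl = j∉A a₁∈A

  construction-near-bipartite : NearBipartite graph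
  construction-near-bipartite = record
    { a₂            = zero
    ; a₁            = suc a₁
    ; A             = Old
    ; A?            = old?
    ; a₁∈A          = a₁∈A
    ; a₂∉A          = λ ()
    ; A-independent = λ {u} {v} → A-indep u v
    ; B-independent = λ {u} {v} → B-indep u v
    ; A-B           = λ {u} {v} → A-B′ u v
    ; a₂-a₁         = x∈p∪q⁺ (inj₁ (x∈⁅x⁆ a₁))
    ; a₂-A          = λ {u} → new-A u
    ; B-split       = λ {w} → split w
    ; B-disjoint    = λ {w} → not-both w
    ; B′-inhabited  = let b , b∈B′ = B′-nonempty in suc b , (B′⇒∉A b∈B′ , λ ()) , x∈p∪q⁺ (inj₂ b∈B′)
    ; B″-inhabited  = let b , b∈B″ = B″-nonempty in suc b , (B″⇒∉A b∈B″ , λ ()) ,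
                        across a₁∈A (B″⇒∉A b∈B″) (inj₂ λ b∈B′ → disjoint (b , x∈p∩q⁺ (b∈B′ , b∈B″)))
    ; A*B           = trans (cong₂ _*_ (sym (∣p∣≡sum A)) (trans (sum-cong-≗ old-B) (sym (∣p∣≡sum (∁ A)))))
                              (∣A∣*∣∁A∣ turán)
    }
    where
    A-indep : ∀ u v → Old u → Old v → ¬ Adj graph u v
    A-indep (suc u) (suc v) u∈A v∈A (inj₁ (_ , v∉A) , _) = v∉A v∈A
    A-indep (suc u) (suc v) u∈A v∈A (inj₂ (_ , u∉A) , _) = u∉A u∈A
    B-indep : ∀ u v → ¬ Old u × u ≢ zero → ¬ Old v × v ≢ zero → ¬ Adj graph u v
    B-indep zero    _       (_ , ≢0)  _         _                    = ≢0 refl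
    B-indep (suc u) zero    _         (_ , ≢0)  _                    = ≢0 refl
    B-indep (suc u) (suc v) (u∉A , _) _         (inj₁ (u∈A , _) , _) = u∉A u∈A
    B-indep (suc u) (suc v) _         (v∉A , _) (inj₂ (v∈A , _) , _) = v∉A v∈A
    A-B′ : ∀ u v → Old u → u ≢ suc a₁ → ¬ Old v × v ≢ zero → Adj graph u v
    A-B′ (suc u) zero    _   _   (_ , ≢0)  = ⊥-elim (≢0 refl)
    A-B′ (suc u) (suc v) u∈A ≢a₁ (v∉A , _) = across u∈A v∉A (inj₁ (≢a₁ ∘ cong suc))
    split : ∀ w → ¬ Old w × w ≢ zero → Adj graph (suc a₁) w ⊎ Adj graph zero w
    split zero    (_ , ≢0)  = ⊥-elim (≢0 refl)
    split (suc j) (j∉A , _) with j ∈? B′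
    ... | yes j∈B′ = inj₂ (x∈p∪q⁺ (inj₂ j∈B′))
    ... | no  j∉B′ = inj₁ (across a₁∈A j∉A (inj₂ j∉B′))
    new-A : ∀ u → Old u → u ≢ suc a₁ → ¬ Adj graph zero u
    new-A (suc j) j∈A ≢a₁ j∈ = B′⇒∉A (new-adjacent (≢a₁ ∘ cong suc) j∈) j∈A
    not-both : ∀ w → ¬ Old w × w ≢ zero → Adj graph (suc a₁) w → ¬ Adj graph zero w
    not-both zero    (_ , ≢0)  _              = ⊥-elim (≢0 refl)
    not-both (suc j) (j∉A , _) (_ , kept , _) = λ j∈ → kept (refl , new-adjacent (∉A⇒≢a₁ j∉A) j∈)
    old-B : ∀ j → 𝟙 (¬? (j ∈? A) ×-dec ¬? (suc j ≟ zero)) ≡ 𝟙 (j ∈? ∁ A)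
    old-B j = 𝟙-cong (¬? (j ∈? A) ×-dec ¬? (suc j ≟ zero)) (j ∈? ∁ A)
      (λ (j∉A , _) → x∉p⇒x∈∁p j∉A) (λ j∈ → x∈∁p⇒x∉p j∈ , λ ())
    ∣A∣*∣∁A∣ : IsTuránClass A → ∣ A ∣ * ∣ ∁ A ∣ ≡ m ^ 2 / 4
    ∣A∣*∣∁A∣ (inj₁ (p , q)) = trans (cong₂ _*_ p q) (⌊m/2⌋*⌈m/2⌉≡m²/4 m)
    ∣A∣*∣∁A∣ (inj₂ (p , q)) = trans (cong₂ _*_ p q) (trans (*-comm ⌈ m /2⌉ ⌊ m /2⌋) (⌊m/2⌋*⌈m/2⌉≡m²/4 m))

  construction-roles : Roles m
  construction-roles = NearBipartite.roles construction-near-bipartite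

  construction-blowup : graph ≈ blowup construction-roles
  construction-blowup {u} {v} = NearBipartite.≈-blowup construction-near-bipartite {u} {v}

-- A construction always has its new vertex at `zero`, whence the condition on `v₀`. The graph of
-- `C` is compared with the blow-up by checking that every vertex has the same class in both.
roles-construction : ∀ (r : Roles m) → v₀ r ≡ zero → Σ[ C ∈ Construction m ] Construction.graph C ≈ blowup r
roles-construction {m} r v₀≡0 = C , λ {u} {v} → NB.kind-adjacent (kinds u) (kinds v)
  where
  c : Fin m → Fin 5
  c = role r ∘ suc

  role-0 : role r zero ≡ 0F
  role-0 = from (v₀-unique r zero) (sym v₀≡0)

  c≢0 : ∀ {j} → c j ≢ 0F
  c≢0 e = case trans (to (v₀-unique r _) e) v₀≡0 of λ ()

  old-v₁ : ∃ λ j → suc j ≡ v₁ r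
  old-v₁ with v₁ r in eq
  ... | zero  = case trans (sym role-0) (trans (cong (role r) (sym eq)) (role-v₁ r)) of λ ()
  ... | suc j = j , refl

  j₁ = proj₁ old-v₁

  c-j₁ : c j₁ ≡ 1F
  c-j₁ = trans (cong (role r) (proj₂ old-v₁)) (role-v₁ r)

  c≡1⇒ : ∀ {j} → c j ≡ 1F → j ≡ j₁
  c≡1⇒ e = Fin.suc-injective (trans (to (v₁-unique r _) e) (sym (proj₂ old-v₁)))

  A? : Decidable₁ (λ j → c j ≡ 1F ⊎ c j ≡ 3F)
  A? j = (c j ≟ 1F) ⊎-dec (c j ≟ 3F)
  B? : ∀ i → Decidable₁ (λ j → c j ≡ i)
  B? i j = c j ≟ i

  Aₛ B′ₛ B″ₛ : Subset m
  Aₛ  = subset A?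
  B′ₛ = subset (B? 4F)
  B″ₛ = subset (B? 2F)

  ∉A : ∀ {j i} → c j ≡ i → i ≢ 1F → i ≢ 3F → j ∉ Aₛ
  ∉A refl i≢1 i≢3 j∈ = [ i≢1 , i≢3 ]′ (∈-subset⁻ A? j∈)

  ∣A∣ : ∣ Aₛ ∣ ≡ sum (α ∘ role r)
  ∣A∣ = trans (∣p∣≡sum Aₛ) (trans (sum-cong-≗ pointwise) (cong (λ i → α i + sum (α ∘ c)) (sym role-0)))
    where
    pointwise : ∀ j → 𝟙 (j ∈? Aₛ) ≡ α (c j)
    pointwise j with c j in e
    ... | 0F = ⊥-elim (c≢0 e)
    ... | 1F = 𝟙-yes (j ∈? Aₛ) (∈-subset⁺ A? (inj₁ e))
    ... | 2F = 𝟙-no (j ∈? Aₛ) (∉A e (λ ()) (λ ()))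
    ... | 3F = 𝟙-yes (j ∈? Aₛ) (∈-subset⁺ A? (inj₂ e))
    ... | 4F = 𝟙-no (j ∈? Aₛ) (∉A e (λ ()) (λ ()))

  ∣∁A∣ : ∣ ∁ Aₛ ∣ ≡ sum (β ∘ role r)
  ∣∁A∣ = trans (∣p∣≡sum (∁ Aₛ)) (trans (sum-cong-≗ pointwise) (cong (λ i → β i + sum (β ∘ c)) (sym role-0)))
    where
    pointwise : ∀ j → 𝟙 (j ∈? ∁ Aₛ) ≡ β (c j)
    pointwise j with c j in e
    ... | 0F = ⊥-elim (c≢0 e)
    ... | 1F = 𝟙-no (j ∈? ∁ Aₛ) λ j∈ → x∈∁p⇒x∉p j∈ (∈-subset⁺ A? (inj₁ e))
    ... | 2F = 𝟙-yes (j ∈? ∁ Aₛ) (x∉p⇒x∈∁p (∉A e (λ ()) (λ ())))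
    ... | 3F = 𝟙-no (j ∈? ∁ Aₛ) λ j∈ → x∈∁p⇒x∉p j∈ (∈-subset⁺ A? (inj₂ e))
    ... | 4F = 𝟙-yes (j ∈? ∁ Aₛ) (x∉p⇒x∈∁p (∉A e (λ ()) (λ ())))

  old-member : ∀ {i} → i ≢ 0F → (∃ λ u → role r u ≡ i) → ∃ λ j → j ∈ subset (B? i)
  old-member i≢0 (zero  , e) = ⊥-elim (i≢0 (trans (sym e) role-0))
  old-member i≢0 (suc j , e) = j , ∈-subset⁺ (B? _) e

  Halves : ℕ → ℕ → ℕ → Set
  Halves k a b = (a ≡ ⌊ k /2⌋ × b ≡ ⌈ k /2⌉) ⊎ (a ≡ ⌈ k /2⌉ × b ≡ ⌊ k /2⌋)

  halves : Halves m (sum (α ∘ role r)) (sum (β ∘ role r))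
  halves = subst (λ k → sum (α ∘ role r) * sum (β ∘ role r) ≡ k ^ 2 / 4 → Halves k (sum (α ∘ role r)) (sum (β ∘ role r)))
                 (∣α∣+∣β∣ r) (a*b≡[a+b]²/4⇒halves _ _) (balanced r)

  C : Construction m
  C = record
    { A           = Aₛ
    ; turán       = subst₂ (Halves m) (sym ∣A∣) (sym ∣∁A∣) halves
    ; a₁          = j₁
    ; a₁∈A        = ∈-subset⁺ A? (inj₁ c-j₁)
    ; B′          = B′ₛ
    ; B″          = B″ₛ
    ; cover       = ⊆-antisym ⊆ ⊇
    ; disjoint    = λ (j , j∈) → let j∈B′ , j∈B″ = x∈p∩q⁻ B′ₛ B″ₛ j∈ in
                      case trans (sym (∈-subset⁻ (B? 4F) j∈B′)) (∈-subset⁻ (B? 2F) j∈B″) of λ ()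
    ; B′-nonempty = old-member (λ ()) (b′ r)
    ; B″-nonempty = old-member (λ ()) (b″ r)
    }
    where
    ⊆ : ∀ {j} → j ∈ B′ₛ ∪ B″ₛ → j ∈ ∁ Aₛ
    ⊆ j∈ with x∈p∪q⁻ B′ₛ B″ₛ j∈
    ... | inj₁ j∈B′ = x∉p⇒x∈∁p (∉A (∈-subset⁻ (B? 4F) j∈B′) (λ ()) (λ ()))
    ... | inj₂ j∈B″ = x∉p⇒x∈∁p (∉A (∈-subset⁻ (B? 2F) j∈B″) (λ ()) (λ ()))
    ⊇ : ∀ {j} → j ∈ ∁ Aₛ → j ∈ B′ₛ ∪ B″ₛ
    ⊇ {j} j∈ with c j in e
    ... | 0F = ⊥-elim (c≢0 e)
    ... | 1F = ⊥-elim (x∈∁p⇒x∉p j∈ (∈-subset⁺ A? (inj₁ e)))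
    ... | 2F = x∈p∪q⁺ (inj₂ (∈-subset⁺ (B? 2F) e))
    ... | 3F = ⊥-elim (x∈∁p⇒x∉p j∈ (∈-subset⁺ A? (inj₂ e)))
    ... | 4F = x∈p∪q⁺ (inj₁ (∈-subset⁺ (B? 4F) e))

  module NB = NearBipartite (construction-near-bipartite C)

  kinds : ∀ u → NB.Kind u (role r u)
  kinds zero = subst (NB.Kind zero) (sym role-0) NB.is-a₂
  kinds (suc j) = go (c j) refl
    where
    not-j₁ : ∀ {i} → c j ≡ i → i ≢ 1F → j ≢ j₁
    not-j₁ e i≢1 refl = i≢1 (trans (sym e) c-j₁)
    go : ∀ i → c j ≡ i → NB.Kind (suc j) i
    go 0F e = ⊥-elim (c≢0 e)
    go 1F e with refl ← c≡1⇒ e = NB.is-a₁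
    go 2F e = NB.in-B″ (∉A e (λ ()) (λ ()) , λ ()) λ j∈ →
      case trans (sym e) (∈-subset⁻ (B? 4F) (new-adjacent C (not-j₁ e λ ()) j∈)) of λ ()
    go 3F e = NB.in-A (∈-subset⁺ A? (inj₂ e)) (not-j₁ e (λ ()) ∘ Fin.suc-injective)
    go 4F e = NB.in-B′ (∉A e (λ ()) (λ ()) , λ ()) (x∈p∪q⁺ (inj₂ (∈-subset⁺ (B? 4F) e)))

-- One vertex goes into each class and the rest alternate between 3F and 2F, so the two sides differ
-- by at most one.
example-roles : 4 ≤ m → Roles m
example-roles (s≤s (s≤s (s≤s (s≤s (z≤n {k}))))) = record
  { role      = c
  ; v₀        = 0F
  ; v₁        = 1F
  ; v₀-unique = λ u → mk⇔ (only-0 u) λ where refl → refl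
  ; v₁-unique = λ u → mk⇔ (only-1 u) λ where refl → refl
  ; b′        = 4F , refl
  ; b″        = 2F , refl
  ; balanced  = trans (cong₂ (λ a b → suc (suc a) * suc (suc b)) (count-α k) (count-β k))
                      (trans (*-comm ⌈ 4 + k /2⌉ ⌊ 4 + k /2⌋) (⌊m/2⌋*⌈m/2⌉≡m²/4 (4 + k)))
  }
  where
  alternate : ∀ {k} → Fin k → Fin 5
  alternate zero          = 3F
  alternate (suc zero)    = 2F
  alternate (suc (suc j)) = alternate j

  c : Fin (5 + k) → Fin 5
  c 0F = 0F
  c 1F = 1F
  c 2F = 2F
  c 3F = 3F
  c 4F = 4F
  c (suc (suc (suc (suc (suc j))))) = alternate j

  alternate-2∨3 : ∀ {k} (j : Fin k) → alternate j ≡ 2F ⊎ alternate j ≡ 3F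
  alternate-2∨3 zero          = inj₂ refl
  alternate-2∨3 (suc zero)    = inj₁ refl
  alternate-2∨3 (suc (suc j)) = alternate-2∨3 j

  only-0 : ∀ u → c u ≡ 0F → u ≡ 0F
  only-0 0F _ = refl
  only-0 (suc (suc (suc (suc (suc j))))) e = case subst (λ i → i ≡ 2F ⊎ i ≡ 3F) e (alternate-2∨3 j) of λ where (inj₁ ()); (inj₂ ())

  only-1 : ∀ u → c u ≡ 1F → u ≡ 1F
  only-1 1F _ = refl
  only-1 (suc (suc (suc (suc (suc j))))) e = case subst (λ i → i ≡ 2F ⊎ i ≡ 3F) e (alternate-2∨3 j) of λ where (inj₁ ()); (inj₂ ())

  count-α : ∀ k → sum {k} (α ∘ alternate) ≡ ⌈ k /2⌉
  count-α 0             = refl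
  count-α 1             = refl
  count-α (suc (suc k)) = cong suc (count-α k)

  count-β : ∀ k → sum {k} (β ∘ alternate) ≡ ⌊ k /2⌋
  count-β 0             = refl
  count-β 1             = refl
  count-β (suc (suc k)) = cong suc (count-β k)

-- The isomorphism is absorbed by pulling the roles back along it.
≅-complement⇒≈ : ∀ {G : Graph (suc m)} (C : Construction m) → G ≅ complement (Construction.graph C) →
  Σ[ r ∈ Roles m ] G ≈ complement (blowup r)
≅-complement⇒≈ C (φ , iso) = pull φ (construction-roles C) , λ {u} {v} → mk⇔
  (λ uv → let φu≢φv , ¬a = to (iso u v) uv in
          φu≢φv ∘ cong (φ ⟨$⟩ʳ_) , ¬a ∘ from (construction-blowup C {φ ⟨$⟩ʳ u} {φ ⟨$⟩ʳ v}))
  (λ (u≢v , ¬a) → from (iso u v)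
          (u≢v ∘ (λ e → trans (sym (inverseˡ φ)) (trans (cong (φ ⟨$⟩ˡ_) e) (inverseˡ φ))) ,
           ¬a ∘ to (construction-blowup C {φ ⟨$⟩ʳ u} {φ ⟨$⟩ʳ v})))

≈-complement⇒≅ : ∀ {G : Graph (suc m)} (r : Roles m) → G ≈ complement (blowup r) →
  Σ[ C ∈ Construction m ] G ≅ complement (Construction.graph C)
≈-complement⇒≅ {m} {G} r G≈ = proj₁ CC , φ , λ u v → mk⇔
    (λ uv → let u≢v , ¬a = to G≈ uv in
            u≢v ∘ injective , ¬a ∘ subst₂ _~_ (back u) (back v) ∘ to (C≈ {φ ⟨$⟩ʳ u} {φ ⟨$⟩ʳ v}))
    (λ (φu≢φv , ¬a) → from G≈
            (φu≢φv ∘ cong (φ ⟨$⟩ʳ_) ,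
             ¬a ∘ from (C≈ {φ ⟨$⟩ʳ u} {φ ⟨$⟩ʳ v}) ∘ subst₂ _~_ (sym (back u)) (sym (back v))))
  where
  -- Exchanges `v₀` with `zero`, the place of the new vertex in a construction.
  φ = Perm.transpose (v₀ r) zero
  transpose-matchˡ : ∀ {n} (i j : Fin n) → Perm.transpose i j ⟨$⟩ʳ i ≡ j
  transpose-matchˡ i j rewrite dec-true (i ≟ i) refl = refl
  CC = roles-construction (pull (Perm.flip φ) r) (transpose-matchˡ (v₀ r) zero)
  C≈ : Construction.graph (proj₁ CC) ≈ blowup (pull (Perm.flip φ) r)
  C≈ {u} {v} = proj₂ CC {u} {v}
  back : ∀ u → role r (φ ⟨$⟩ˡ (φ ⟨$⟩ʳ u)) ≡ role r u
  back u = cong (role r) (inverseˡ φ)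
  injective : ∀ {u v} → φ ⟨$⟩ʳ u ≡ φ ⟨$⟩ʳ v → u ≡ v
  injective e = trans (sym (inverseˡ φ)) (trans (cong (φ ⟨$⟩ˡ_) e) (inverseˡ φ))

-- Extremal graphs

-- One neighbourhood contains the other and both have the same finite size. Mostly used with `v` as
-- the larger side, to show that a vertex of degree Δ without neighbours in `S` sees all of N.
same-degree : ∀ (G : Graph n) {a b} → (∀ {u} → Adj G a u → Adj G b u) → deg G a ≡ deg G b → ∀ {u} → Adj G b u → Adj G a u
same-degree G {a} {b} N⊆ eq {u} bu =
  𝟙≡1⇒ (adj? G a u) (trans (sum-tight pointwise (sym eq) u) (𝟙-yes (adj? G b u) bu))
  where
  pointwise : ∀ u → χ G a u ≤ χ G b u
  pointwise u with adj? G a u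
  ... | yes au = ≤-reflexive (sym (𝟙-yes (adj? G b u) (N⊆ au)))
  ... | no  _  = z≤n

complete-or-missing : ∀ (G : Graph n) {S : Pred (Fin n) 0ℓ} (S? : Decidable₁ S) →
  (∃ λ x → S x × (∀ w → ¬ S w → Adj G x w)) ⊎ (∀ {u} → S u → ∃ λ w → ¬ S w × ¬ Adj G u w)
complete-or-missing G S? with any? (λ x → S? x ×-dec all? λ w → ¬? (S? w) →-dec adj? G x w)
... | yes c = inj₁ c
... | no ¬c = inj₂ λ {u} su → decidable-stable (any? λ w → ¬? (S? w) ×-dec ¬? (adj? G u w)) λ none →
  ¬c (u , su , λ w ¬sw → decidable-stable (adj? G u w) λ ¬uw → none (w , ¬sw , ¬uw))

G₂-bipartite-bound : ∀ (G : Graph (suc m)) {S : Pred (Fin (suc m)) 0ℓ} → Decidable₁ S →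
  Independent (distanceGraph 2 G) S → Independent (distanceGraph 2 G) (¬_ ∘ S) →
  ∣E distanceGraph 2 G ∣ ≤ m ^ 2 / 4
G₂-bipartite-bound G {S} S? indS ind¬S
  with complete-or-missing (distanceGraph 2 G) S? | complete-or-missing (distanceGraph 2 G) (¬? ∘ S?)
... | inj₂ missing | _ = bipartite-bound (distanceGraph 2 G) S? indS ind¬S missing
... | inj₁ _ | inj₂ missing = bipartite-bound (distanceGraph 2 G) (¬? ∘ S?) ind¬S
        (λ ¬¬su ¬¬sw → indS (decidable-stable (S? _) ¬¬su) (decidable-stable (S? _) ¬¬sw)) missing
... | inj₁ (x , sx , x-full) | inj₁ (y , ¬sy , y-full)
  -- The midpoint is adjacent in `G` to both x and y, yet it lies on one of the two sides, and the
  -- vertex complete to that side must have it at distance 2.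
  with w , xw , wy ← midpoint (x-full y ¬sy) with S? w
...   | yes sw = ⊥-elim (distance₂⇒¬adj (y-full w λ ¬sw → ¬sw sw) (adj-sym G wy))
...   | no ¬sw = ⊥-elim (distance₂⇒¬adj (x-full w ¬sw) xw)

module Extremal (G : Graph (suc m)) (△-free : TriangleFree G)
  (bipartite : ∀ {S : Pred (Fin (suc m)) 0ℓ} → Decidable₁ S →
    Independent G S → Independent G (¬_ ∘ S) → ∣E G ∣ ≤ m ^ 2 / 4) where

  v : Fin (suc m)
  v = proj₁ (argmax (deg G))

  open MaxDegree G △-free v (proj₂ (argmax (deg G)))

  S-edge? : Dec (∃ λ x → ∃ λ y → (S x × S y) × Adj G x y)
  S-edge? = any? λ x → any? λ y → (S? x ×-dec S? y) ×-dec adj? G x y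

  ∣E∣≤m²/4+1 : ∣E G ∣ ≤ m ^ 2 / 4 + 1
  ∣E∣≤m²/4+1 with S-edge?
  ... | yes (x , y , (sx , sy) , xy) = Edge.edge-bound sx sy xy
  ... | no none = ≤-trans (bipartite S? (λ sx sy xy → none (_ , _ , (sx , sy) , xy)) ind-N) (m≤m+n _ 1)

  module _ (max : m ^ 2 / 4 + 1 ≤ ∣E G ∣) where

    non-bipartite : ∀ {S : Pred (Fin (suc m)) 0ℓ} → Decidable₁ S → Independent G S → ¬ Independent G (¬_ ∘ S)
    non-bipartite S? indS ind¬S =
      1+n≰n (≤-trans (≤-reflexive (+-comm 1 (m ^ 2 / 4))) (≤-trans max (bipartite S? indS ind¬S)))

    N-independent : Independent G (Adj G v)
    N-independent vu vw uw = △-free vu uw vw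

    ∣S∖x∣≡s : ∀ {x} → S x → sum (λ u → 𝟙 (S? u ×-dec ¬? (u ≟ x))) ≡ s
    ∣S∖x∣≡s {x} sx = suc-injective (begin
      suc (sum rest)                         ≡⟨ +-comm 1 (sum rest) ⟩
      sum rest + 1                           ≡⟨ cong (sum rest +_) (sum-𝟙≟ x) ⟨
      sum rest + sum (λ u → 𝟙 (u ≟ x))       ≡⟨ ∑-distrib-+ rest (λ u → 𝟙 (u ≟ x)) ⟨
      sum (λ u → rest u + 𝟙 (u ≟ x))         ≡⟨ sum-cong-≗ pointwise ⟩
      sum σ                                  ≡⟨ ∣S∣≡1+s ⟩
      suc s                                  ∎)
      where
      open ≡-Reasoning
      rest : Fin (suc m) → ℕ
      rest u = 𝟙 (S? u ×-dec ¬? (u ≟ x))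
      pointwise : ∀ u → rest u + 𝟙 (u ≟ x) ≡ σ u
      pointwise u = by-cases (u ≟ x)
        where
        by-cases : (d : Dec (u ≡ x)) → 𝟙 (S? u ×-dec ¬? d) + 𝟙 d ≡ σ u
        by-cases (yes refl) =
          trans (cong (_+ 1) (𝟙-no (S? u ×-dec ¬? (yes (refl {x = u}))) λ (_ , u≢u) → u≢u refl))
                (sym (𝟙-yes (S? u) sx))
        by-cases (no u≢x)   = trans (+-identityʳ _) (𝟙-cong (S? u ×-dec ¬? (no u≢x)) (S? u) proj₁ (_, u≢x))

    OnlyNeighbour : Fin (suc m) → Fin (suc m) → Set
    OnlyNeighbour x y = ∀ {z} → S z → Adj G x z → z ≡ y

    module SingleEdge {x y} (sx : S x) (sy : S y) (xy : Adj G x y)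
                      (x-only : OnlyNeighbour x y) (y-only : OnlyNeighbour y x) where

      open Edge.Tight sx sy xy max

      S∖y : Pred (Fin (suc m)) 0ℓ
      S∖y u = S u × u ≢ y

      S∖y? : Decidable₁ S∖y
      S∖y? u = S? u ×-dec ¬? (u ≟ y)

      -- By tightness every edge inside `S` touches x or y, and one touching x must end at y;
      -- deleting y leaves none.
      S∖y-independent : Independent G S∖y
      S∖y-independent {u} {w} (su , u≢y) (sw , w≢y) uw with u ≟ x | w ≟ x
      ... | yes refl | _        = w≢y (x-only sw uw)
      ... | no _     | yes refl = u≢y (x-only su (adj-sym G uw))
      ... | no u≢x   | no w≢x   = rest-independent su sw u≢x u≢y w≢x w≢y uw

      ∉⇒N : ∀ {u} → ¬ S∖y u → u ≢ y → Adj G v u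
      ∉⇒N ¬u u≢y = ¬S⇒N λ su → ¬u (su , u≢y)

      -- Such a vertex has no neighbour in `S`, so its Δ neighbours fill N.
      complete-to-N : ∀ {u w} → S∖y u → u ≢ x → Adj G v w → Adj G u w
      complete-to-N {u} (su , u≢y) u≢x =
        same-degree G (λ {w} uw → ¬S⇒N λ sw → leaves-S sw uw) (deg≡Δ su u≢x u≢y)
        where
        leaves-S : ∀ {w} → S w → ¬ Adj G u w
        leaves-S {w} sw uw with w ≟ y
        ... | yes refl = u≢x (y-only su (adj-sym G uw))
        ... | no w≢y   = S∖y-independent (su , u≢y) (sw , w≢y) uw

      -- Otherwise y could be moved to the side of N.
      y-meets-N : ∃ λ w → Adj G v w × Adj G y w
      y-meets-N = decidable-stable (any? λ w → adj? G v w ×-dec adj? G y w) λ none →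
        non-bipartite S∖y? S∖y-independent λ {u} {w} → other-side none u w
        where
        other-side : ¬ (∃ λ w → Adj G v w × Adj G y w) → ∀ u w → ¬ S∖y u → ¬ S∖y w → ¬ Adj G u w
        other-side none u w ¬u ¬w uw with u ≟ y | w ≟ y
        ... | yes refl | yes refl = adj-irrefl G uw
        ... | yes refl | no w≢y   = none (w , ∉⇒N ¬w w≢y , uw)
        ... | no u≢y   | yes refl = none (u , ∉⇒N ¬u u≢y , adj-sym G uw)
        ... | no u≢y   | no w≢y   = N-independent (∉⇒N ¬u u≢y) (∉⇒N ¬w w≢y) uw

    -- Here A comes from `S` and B is N, of sizes `s` and Δ. That B′ and B″ are nonempty is one
    -- argument, applied to y and, by symmetry, to x.
    single-edge : ∀ {x y} → S x → S y → Adj G x y → OnlyNeighbour x y → OnlyNeighbour y x → NearBipartite G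
    single-edge {x} {y} sx sy xy x-only y-only = record
      { a₂            = y
      ; a₁            = x
      ; A             = S∖y
      ; A?            = S∖y?
      ; a₁∈A          = sx , λ where refl → adj-irrefl G xy
      ; a₂∉A          = λ (_ , y≢y) → y≢y refl
      ; A-independent = S∖y-independent
      ; B-independent = λ (¬u , u≢y) (¬w , w≢y) → N-independent (∉⇒N ¬u u≢y) (∉⇒N ¬w w≢y)
      ; A-B           = λ u∈A u≢x (¬w , w≢y) → complete-to-N u∈A u≢x (∉⇒N ¬w w≢y)
      ; a₂-a₁         = adj-sym G xy
      ; a₂-A          = λ (su , _) u≢x yu → u≢x (y-only su yu)
      ; B-split       = λ (¬w , w≢y) → x∨y (∉⇒N ¬w w≢y)
      ; B-disjoint    = λ _ xw yw → △-free xy yw xw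
      ; B′-inhabited  = let w , vw , yw = y-meets-N in w , N⇒B vw , yw
      ; B″-inhabited  = let w , vw , xw = SingleEdge.y-meets-N sy sx (adj-sym G xy) y-only x-only in w , N⇒B vw , xw
      ; A*B           = trans (cong₂ _*_ (∣S∖x∣≡s sy) (sum-cong-≗ ∣B∣)) sΔ≡m²/4
      }
      where
      open SingleEdge sx sy xy x-only y-only
      open Edge.Tight sx sy xy max
      N⇒B : ∀ {u} → Adj G v u → ¬ S∖y u × u ≢ y
      N⇒B vu = (λ (su , _) → su vu) , λ where refl → sy vu
      ∣B∣ : ∀ u → 𝟙 (¬? (S∖y? u) ×-dec ¬? (u ≟ y)) ≡ χ G v u
      ∣B∣ u = 𝟙-cong (¬? (S∖y? u) ×-dec ¬? (u ≟ y)) (adj? G v u) (λ (¬u , u≢y) → ∉⇒N ¬u u≢y) N⇒B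

    module Star {x y z} (sx : S x) (sy : S y) (sz : S z) (xy : Adj G x y) (xz : Adj G x z) (y≢z : y ≢ z) where

      private
        module XY = Edge.Tight sx sy xy max
        module XZ = Edge.Tight sx sz xz max

      y≢x : y ≢ x
      y≢x refl = adj-irrefl G xy

      -- Tightness holds for xy and for xz, so every edge inside `S` meets both. If it avoids x it
      -- must be yz, which closes a triangle.
      S∖x-independent : ∀ {u w} → S u × u ≢ x → S w × w ≢ x → ¬ Adj G u w
      S∖x-independent {u} {w} (su , u≢x) (sw , w≢x) uw with u ≟ y | w ≟ y
      ... | no u≢y   | no w≢y   = XY.rest-independent su sw u≢x u≢y w≢x w≢y uw
      ... | yes refl | yes refl = adj-irrefl G uw
      ... | yes refl | no _ with w ≟ z
      ...   | yes refl = △-free xy uw xz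
      ...   | no w≢z   = XZ.rest-independent su sw u≢x y≢z w≢x w≢z uw
      S∖x-independent {u} {w} (su , u≢x) (sw , w≢x) uw | no _ | yes refl with u ≟ z
      ...   | yes refl = △-free xz uw xy
      ...   | no u≢z   = XZ.rest-independent su sw u≢x u≢z w≢x y≢z uw

      -- Tightness at xy leaves the degree of its own end y open; tightness at xz settles it.
      deg-S∖x : ∀ {u} → S u → u ≢ x → deg G u ≡ Δ
      deg-S∖x {u} su u≢x with u ≟ y
      ... | no u≢y   = XY.deg≡Δ su u≢x u≢y
      ... | yes refl = XZ.deg≡Δ su u≢x y≢z

      -- One of the Δ neighbours of y is x, which lies outside N, so y cannot see all of N. The
      -- vertex it misses becomes `a₁`.
      centre : ∃ λ w → Adj G v w × ¬ Adj G y w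
      centre = decidable-stable (any? λ w → adj? G v w ×-dec ¬? (adj? G y w)) λ none →
        sx (same-degree G (λ {w} vw → decidable-stable (adj? G y w) λ ¬yw → none (w , vw , ¬yw))
                          (sym (deg-S∖x sy y≢x)) (adj-sym G xy))

      a = proj₁ centre
      va = proj₁ (proj₂ centre)
      ¬ya = proj₂ (proj₂ centre)

      xa : Adj G x a
      xa = [ id , ⊥-elim ∘ ¬ya ]′ (XY.x∨y va)

      -- Two neighbours of x in N would both be missed by y, which misses only one.
      x-meets-N-once : ∀ {w} → Adj G v w → Adj G x w → w ≡ a
      x-meets-N-once {w} vw xw = decidable-stable (w ≟ a) λ w≢a → 1+n≰n (+-cancelˡ-≤ Δ 2 1 (begin
        Δ + 2                                                            ≡⟨ cong (_+ 2) (deg-S∖x sy y≢x) ⟨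
        deg G y + 2
          ≡⟨ cong (deg G y +_) (cong₂ _+_ (sum-𝟙≟ a) (sum-𝟙≟ w)) ⟨
        deg G y + (sum (λ u → 𝟙 (u ≟ a)) + sum (λ u → 𝟙 (u ≟ w)))
          ≡⟨ cong (deg G y +_) (∑-distrib-+ (λ u → 𝟙 (u ≟ a)) (λ u → 𝟙 (u ≟ w))) ⟨
        deg G y + sum (λ u → 𝟙 (u ≟ a) + 𝟙 (u ≟ w))
          ≡⟨ ∑-distrib-+ (χ G y) (λ u → 𝟙 (u ≟ a) + 𝟙 (u ≟ w)) ⟨
        sum (λ u → χ G y u + (𝟙 (u ≟ a) + 𝟙 (u ≟ w)))                    ≤⟨ sum-mono (pointwise w≢a) ⟩
        sum (λ u → χ G v u + 𝟙 (u ≟ x))                                  ≡⟨ ∑-distrib-+ (χ G v) (λ u → 𝟙 (u ≟ x)) ⟩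
        Δ + sum (λ u → 𝟙 (u ≟ x))                                        ≡⟨ cong (Δ +_) (sum-𝟙≟ x) ⟩
        Δ + 1                                                            ∎))
        where
        open ≤-Reasoning
        ¬yw : ¬ Adj G y w
        ¬yw yw = △-free xy yw xw
        -- Apart from x, the neighbours of y lie in N, and `a` and `w` are two members of N that y
        -- misses.
        pointwise : w ≢ a → ∀ u → χ G y u + (𝟙 (u ≟ a) + 𝟙 (u ≟ w)) ≤ χ G v u + 𝟙 (u ≟ x)
        pointwise w≢a u with u ≟ a | u ≟ w
        ... | yes refl | yes refl = ⊥-elim (w≢a refl)
        ... | yes refl | no _ rewrite 𝟙-no (adj? G y u) ¬ya | 𝟙-yes (adj? G v u) va = s≤s z≤n
        ... | no _ | yes refl rewrite 𝟙-no (adj? G y u) ¬yw | 𝟙-yes (adj? G v u) vw = s≤s z≤n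
        ... | no _ | no _ with adj? G y u | u ≟ x
        ...   | no _   | _        = z≤n
        ...   | yes _  | yes refl = m≤n+m 1 _
        ...   | yes yu | no u≢x rewrite 𝟙-yes (adj? G v u) (¬S⇒N λ su → S∖x-independent (sy , y≢x) (su , u≢x) yu) = ≤-refl

      complete-to-N : ∀ {u w} → S u → u ≢ x → ¬ Adj G x u → Adj G v w → Adj G u w
      complete-to-N {u} su u≢x ¬xu = same-degree G (λ uw → ¬S⇒N λ sw → leaves-S sw uw) (deg-S∖x su u≢x)
        where
        leaves-S : ∀ {w} → S w → ¬ Adj G u w
        leaves-S {w} sw uw with w ≟ x
        ... | yes refl = ¬xu (adj-sym G uw)
        ... | no w≢x   = S∖x-independent (su , u≢x) (sw , w≢x) uw

      near-bipartite : NearBipartite G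
      near-bipartite = record
        { a₂            = x
        ; a₁            = a
        ; A             = Adj G v
        ; A?            = adj? G v
        ; a₁∈A          = va
        ; a₂∉A          = sx
        ; A-independent = N-independent
        ; B-independent = S∖x-independent
        ; A-B           = λ vu u≢a (sw , w≢x) → adj-sym G (N-complete sw w≢x vu u≢a)
        ; a₂-a₁         = xa
        ; a₂-A          = λ vu u≢a xu → u≢a (x-meets-N-once vu xu)
        ; B-split       = split
        ; B-disjoint    = λ _ aw xw → △-free xa aw xw
        ; B′-inhabited  = y , (sy , y≢x) , xy
        -- The vertex `v` itself serves: it lies in `S`, differs from x because y is not its
        -- neighbour, and sees `a`.
        ; B″-inhabited  = v , (adj-irrefl G , λ where refl → sy xy) , adj-sym G va
        ; A*B           = trans (cong (Δ *_) (∣S∖x∣≡s sx)) (trans (*-comm Δ s) XY.sΔ≡m²/4)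
        }
        where
        N-complete : ∀ {u w} → S w → w ≢ x → Adj G v u → u ≢ a → Adj G w u
        N-complete {u} {w} sw w≢x vu u≢a with adj? G x w
        ... | no ¬xw = complete-to-N sw w≢x ¬xw vu
        -- Tightness is applied to the edge xw of `S`: every vertex of N sees x or w, and only `a`
        -- sees x.
        ... | yes xw = [ ⊥-elim ∘ u≢a ∘ x-meets-N-once vu , id ]′ (Edge.Tight.x∨y sx sw xw max vu)
        split : ∀ {w} → S w × w ≢ x → Adj G a w ⊎ Adj G x w
        split {w} (sw , w≢x) with adj? G x w
        ... | yes xw = inj₂ xw
        ... | no ¬xw = inj₁ (adj-sym G (complete-to-N sw w≢x ¬xw va))

    extremal-near-bipartite : NearBipartite G
    extremal-near-bipartite with S-edge?
    ... | no none = ⊥-elim (non-bipartite S? (λ sx sy xy → none (_ , _ , (sx , sy) , xy)) ind-N)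
    -- An end with a second neighbour in `S` is the centre of a star; if neither end has one, xy is
    -- isolated within `S`.
    ... | yes (x , y , (sx , sy) , xy) with other x y | other y x
      where
      other : ∀ x y → Dec (∃ λ z → (S z × Adj G x z) × y ≢ z)
      other x y = any? λ z → (S? z ×-dec adj? G x z) ×-dec ¬? (y ≟ z)
    ...   | yes (z , (sz , xz) , y≢z) | _ = Star.near-bipartite sx sy sz xy xz y≢z
    ...   | no _ | yes (z , (sz , yz) , x≢z) = Star.near-bipartite sy sx sz (adj-sym G xy) yz x≢z
    ...   | no no-x | no no-y = single-edge sx sy xy (only no-x) (only no-y)
      where
      only : ∀ {x y} → ¬ (∃ λ z → (S z × Adj G x z) × y ≢ z) → OnlyNeighbour x y
      only {x} {y} none {z} sz xz = sym (decidable-stable (y ≟ z) λ y≢z → none (z , (sz , xz) , y≢z))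

-- The extremal number and the extremal graphs

free⇒triangle-free : ∀ {G : Graph n} → Free (complete 3) G → TriangleFree G
free⇒triangle-free {n} {G} free {u} {v} {w} uv vw uw = free (mk↣ injective , preserves)
  where
  f : Fin 3 → Fin n
  f 0F = u
  f 1F = v
  f 2F = w
  preserves : ∀ {i j} → i ≢ j → Adj G (f i) (f j)
  preserves {0F} {0F} i≢i = ⊥-elim (i≢i refl)
  preserves {0F} {1F} _   = uv
  preserves {0F} {2F} _   = uw
  preserves {1F} {0F} _   = adj-sym G uv
  preserves {1F} {1F} i≢i = ⊥-elim (i≢i refl)
  preserves {1F} {2F} _   = vw
  preserves {2F} {0F} _   = adj-sym G uw
  preserves {2F} {1F} _   = adj-sym G vw
  preserves {2F} {2F} i≢i = ⊥-elim (i≢i refl)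
  injective : ∀ {i j} → f i ≡ f j → i ≡ j
  injective {i} {j} fi≡fj = decidable-stable (i ≟ j) λ i≢j →
    adj-irrefl G (subst (Adj G (f i)) (sym fi≡fj) (preserves i≢j))

triangle-free⇒free : ∀ {G : Graph n} → TriangleFree G → Free (complete 3) G
triangle-free⇒free △-free (_ , preserves) =
  △-free (preserves {0F} {1F} λ ()) (preserves {1F} {2F} λ ()) (preserves {0F} {2F} λ ())

≈-blowup⇒free : ∀ {G : Graph (suc m)} (r : Roles m) → G ≈ blowup r → Free (complete 3) G
≈-blowup⇒free {G = G} r G≈ = triangle-free⇒free {G = G} λ uv vw uw → blowup-triangle-free r (to G≈ uv) (to G≈ vw) (to G≈ uw)

G₂-bound : ∀ (G : Graph (suc m)) → Free (complete 3) (distanceGraph 2 G) → ∣E distanceGraph 2 G ∣ ≤ m ^ 2 / 4 + 1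
G₂-bound G free =
  Extremal.∣E∣≤m²/4+1 (distanceGraph 2 G) (free⇒triangle-free {G = distanceGraph 2 G} free) (G₂-bipartite-bound G)

G₂-near-bipartite : ∀ (G : Graph (suc m)) → Free (complete 3) (distanceGraph 2 G) →
  m ^ 2 / 4 + 1 ≤ ∣E distanceGraph 2 G ∣ → NearBipartite (distanceGraph 2 G)
G₂-near-bipartite G free =
  Extremal.extremal-near-bipartite (distanceGraph 2 G) (free⇒triangle-free {G = distanceGraph 2 G} free) (G₂-bipartite-bound G)

complement-blowup-attains : ∀ {G : Graph (suc m)} (r : Roles m) → 4 ≤ m → G ≈ complement (blowup r) →
  Free (complete 3) (distanceGraph 2 G) × ∣E distanceGraph 2 G ∣ ≡ m ^ 2 / 4 + 1
complement-blowup-attains {m} {G} r 4≤m G≈ =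
  ≈-blowup⇒free {G = distanceGraph 2 G} r G₂≈ , trans (∣E∣-cong {G = distanceGraph 2 G} {blowup r} G₂≈) (∣E-blowup∣ r)
  where
  G₂≈ : distanceGraph 2 G ≈ blowup r
  G₂≈ = complement-blowup-G₂ {G = G} r 4≤m G≈

G₂-is-ex : 4 ≤ m → IsEx 2 (suc m) (complete 3) (m ^ 2 / 4 + 1)
G₂-is-ex {m} 4≤m =
  (complement (blowup r) , complement-blowup-attains {G = complement (blowup r)} r 4≤m (mk⇔ id id)) ,
  λ (G , free , ∣E∣≡d) → subst (_≤ m ^ 2 / 4 + 1) ∣E∣≡d (G₂-bound G free)
  where
  r : Roles m
  r = example-roles 4≤m

theorem1 : (n : ℕ) → 5 ≤ n →
    IsEx 2 n (complete 3) ((n ∸ 1) ^ 2 / 4 + 1)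
    × ((G : Graph n) →
    IsExtremal 2 (complete 3) G
    ⇔ (Σ[ C ∈ Construction (n ∸ 1) ] G ≅ complement (Construction.graph C)))
theorem1 (suc m) (s≤s 4≤m) = is-ex , λ G → mk⇔ (extremal⇒construction G) (construction⇒extremal G)
  where
  is-ex : IsEx 2 (suc m) (complete 3) (m ^ 2 / 4 + 1)
  is-ex = G₂-is-ex 4≤m

  extremal⇒construction : ∀ (G : Graph (suc m)) → IsExtremal 2 (complete 3) G →
    Σ[ C ∈ Construction m ] G ≅ complement (Construction.graph C)
  extremal⇒construction G (free , _ , e-max) =
    ≈-complement⇒≅ {G = G} roles (G₂-blowup-complement {G = G} roles 4≤m (λ {u} {v} → ≈-blowup {u} {v}))
    -- Comparing the maximal graph with the explicit example supplies the lower bound on its edge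
    -- count.
    where open NearBipartite (G₂-near-bipartite G free (e-max (proj₁ is-ex))) using (roles; ≈-blowup)

  construction⇒extremal : ∀ (G : Graph (suc m)) → Σ[ C ∈ Construction m ] G ≅ complement (Construction.graph C) →
    IsExtremal 2 (complete 3) G
  construction⇒extremal G (C , G≅) = proj₁ attains , subst (IsEx 2 (suc m) (complete 3)) (sym (proj₂ attains)) is-ex
    where
    r = ≅-complement⇒≈ {G = G} C G≅
    attains = complement-blowup-attains {G = G} (proj₁ r) 4≤m (λ {u} {v} → proj₂ r {u} {v})
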